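{- There is an absolute constant $C>0$ such that for every integer $d\ge 1$ and every integer $N\ge 3$, every subset $A\subseteq\{1,\dots,N\}$ with $$|A|\geq\frac{CN}{(\log\log N)^{\frac{1}{d(d+1)-1}}}$$ contains a non-trivial $d$-configuration.
   Context: A $d$-configuration is a set of the form $\{n_i+n_j+a\}_{1\le i\le j\le d}$ with $a,n_1,\dots,n_d\in\mathbb{N}$; it is non-trivial if $n_i\neq n_j$ for all $i\ne j$. $A$ contains it if all $n_i+n_j+a$ lie in $A$. -}

module Defs where

open import Data.Nat as ℕ using (ℕ; zero; suc; _∸_)
open import Data.Nat.Base using (_!)
open import Data.Nat.Properties using (_!≢0)
open import Data.Integer using (+_)
open import Data.Rational as ℚ using (ℚ; 0ℚ; 1ℚ; _+_; _*_; _/_; _≤_)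
open import Data.Fin using (Fin; toℕ; _≤_)
open import Data.Fin.Subset using (Subset; _∈_)
open import Data.Product using (Σ; ∃; _×_)
open import Function.Definitions using (Injective)
open import Relation.Binary.PropositionalEquality using (_≡_)

-- p / q as a rational (q = 0 gives 0; only used with q > 0)
ratio : ℕ → ℕ → ℚ
ratio p zero    = 0ℚ
ratio p (suc q) = (+ p) / suc q

pow : ℚ → ℕ → ℚ
pow x zero    = 1ℚ
pow x (suc n) = x * pow x n

invFact : ℕ → ℚ
invFact i = (+ 1) / (i !) where instance _ = i !≢0

expPartial : ℕ → ℚ → ℚ
expPartial zero    x = 0ℚ
expPartial (suc m) x = expPartial m x + pow x m * invFact m

-- For rational t ≥ 0 and natural N:  exp(exp t) ≤ N  (real exponential).
-- Since exp is the supremum of its (increasing, for nonnegative arguments)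
-- Taylor partial sums, and these are monotone and continuous,
-- exp(exp t) = sup_{m,j} expPartial m (expPartial j t).
-- Equivalently (for N ≥ 3, t ≥ 0):  t ≤ log log N.
ExpExpLe : ℚ → ℕ → Set
ExpExpLe t N = ∀ m j → expPartial m (expPartial j t) ℚ.≤ ((+ N) / 1)

-- A ⊆ {1,…,N} encoded as a subset of Fin N, index i standing for i+1.
InSet : {N : ℕ} → Subset N → ℕ → Set
InSet {N} A x = Σ (Fin N) λ i → (suc (toℕ i) ≡ x) × (i ∈ A)

ContainsNontrivialConfig : {N : ℕ} → ℕ → Subset N → Set
ContainsNontrivialConfig {N} d A =
  Σ ℕ λ a → Σ (Fin d → ℕ) λ n →
    Injective _≡_ _≡_ n ×
    (∀ (i j : Fin d) → i Data.Fin.≤ j → InSet A (n i ℕ.+ n j ℕ.+ a))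

{-# OPTIONS --safe #-}
module Submission where

-- Call x, y adjacent when a + x + y ∈ A. A d-configuration is a d-clique, with distinct vertices, in
-- X = {x : a + 2x ∈ A}; for one parity a the set X has at least half the elements of A.  If A has about
-- the expected number of adjacent pairs inside every subset of the relevant sizes, a clique is
-- built greedily.  Otherwise f = N·1_A - |A|, wrapped around modulo N, correlates with a product set, so
-- the Hankel operator G with kernel f(x + y) has large norm, and this forces A to be denser on some
-- progression of common difference q < Q and length L.  This is seen without characters.  Put w = Gᵖu.
-- Positivity of ‖Σ_{a<Q} w(· + a(m - m′))‖², averaged over m, m′ distributed as sums of p elements of [0, L),
-- equals an average over a, b < Q of ‖P_{a-b}ᵖ w‖², where P_q averages over progressions of difference q.
-- The terms m = m′ alone contribute more than the terms a = b, so some q ≠ 0 has large ‖P_qᵖ Gᵖ u‖, and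
-- that is at most the p-th power of the ℓ¹ norm of the averages of f over progressions of difference q.
-- With p as large as log L nothing is lost, hence f has a large positive average on one of them.
-- Passing to it costs N → N^{1/8} and raises the density by a fixed amount of order δ^{2d+1};
-- as d(d + 1) - 1 ≥ 2d + 1 for d ≥ 2, double exponential N suffices.

open import Defs
open import Data.Nat as ℕ using (ℕ; zero; suc; _∸_; _!)
import Data.Nat.Properties as ℕₚ
import Data.Nat.Tactic.RingSolver as ℕ-Solver
open import Data.Nat.DivMod using (_%_; _/_; m<n⇒m%n≡m; [m+n]%n≡m%n; m%n<n; m≡m%n+[m/n]*n; m/n*n≤m)
open import Data.Integer as ℤ using (ℤ; +_; 0ℤ; 1ℤ)
import Data.Integer.Properties as ℤₚ
import Data.Integer.Tactic.RingSolver as ℤ-Solver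
open import Data.Rational as ℚ using (ℚ; 0ℚ)
import Data.Rational.Properties as ℚₚ
open import Data.Rational.Unnormalised as ℚᵘ using (mkℚᵘ)
import Data.Rational.Unnormalised.Properties as ℚᵘₚ
import Algebra.Properties.AbelianGroup ℤₚ.+-0-abelianGroup as ℤ+
open import Data.Bool using (Bool; true; false; if_then_else_; T; _∧_; not)
open import Data.Empty using (⊥; ⊥-elim)
open import Data.Fin as Fin using (Fin)
open import Data.Product using (Σ; ∃; _×_; _,_; proj₁; proj₂)
open import Data.Sum using (_⊎_; inj₁; inj₂; [_,_]′)
open import Data.Vec using ([]; _∷_; here; there)
open import Function.Definitions using (Injective)
open import Relation.Nullary using (yes; no)
open import Relation.Nullary.Decidable using (_×-dec_)
open import Relation.Binary.Definitions using (tri<; tri≈; tri>)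
open import Relation.Binary.PropositionalEquality

-- Finite sums of integers and the Cauchy-Schwarz inequality.

module IntegerSums where
  open import Data.Integer using (∣_∣; _+_; _*_; _-_; -_; _≤_; _^_)

  0≤*0≤ : ∀ {i j} → 0ℤ ≤ i → 0ℤ ≤ j → 0ℤ ≤ i * j
  0≤*0≤ {+ m} {+ n} _ _ = subst (0ℤ ≤_) (ℤₚ.pos-* m n) (ℤ.+≤+ ℕ.z≤n)

  *-mono-≤ : ∀ {i j k l} → 0ℤ ≤ i → i ≤ j → 0ℤ ≤ k → k ≤ l → i * k ≤ j * l
  *-mono-≤ {i} {j} {k} {l} 0≤i i≤j 0≤k k≤l = ℤₚ.≤-trans
    (ℤₚ.*-monoˡ-≤-nonNeg i {{ℤ.nonNegative 0≤i}} k≤l)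
    (ℤₚ.*-monoʳ-≤-nonNeg l {{ℤ.nonNegative (ℤₚ.≤-trans 0≤k k≤l)}} i≤j)

  *-monoˡ : ∀ {i j k} → 0ℤ ≤ k → i ≤ j → k * i ≤ k * j
  *-monoˡ {k = k} 0≤k = ℤₚ.*-monoˡ-≤-nonNeg k {{ℤ.nonNegative 0≤k}}

  0≤square : ∀ i → 0ℤ ≤ i * i
  0≤square (+ m) = 0≤*0≤ {+ m} (ℤ.+≤+ ℕ.z≤n) (ℤ.+≤+ ℕ.z≤n)
  0≤square ℤ.-[1+ m ] = ℤ.+≤+ ℕ.z≤n

  +∣∣-square : ∀ i → + ∣ i ∣ * + ∣ i ∣ ≡ i * i
  +∣∣-square (+ m) = refl
  +∣∣-square ℤ.-[1+ m ] = refl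

  ≤+∣∣ : ∀ i → i ≤ + ∣ i ∣
  ≤+∣∣ (+ m) = ℤₚ.≤-refl
  ≤+∣∣ ℤ.-[1+ m ] = ℤ.-≤+

  0≤^ : ∀ {i} n → 0ℤ ≤ i → 0ℤ ≤ i ^ n
  0≤^ zero _ = ℤ.+≤+ ℕ.z≤n
  0≤^ (suc n) p = 0≤*0≤ p (0≤^ n p)

  ^-mono-≤ : ∀ {i j} n → 0ℤ ≤ i → i ≤ j → i ^ n ≤ j ^ n
  ^-mono-≤ zero _ _ = ℤₚ.≤-refl
  ^-mono-≤ (suc n) 0≤i i≤j = *-mono-≤ 0≤i i≤j (0≤^ n 0≤i) (^-mono-≤ n 0≤i i≤j)

  ^-distribʳ-* : ∀ i j n → (i * j) ^ n ≡ i ^ n * j ^ n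
  ^-distribʳ-* i j zero = refl
  ^-distribʳ-* i j (suc n) = trans (cong (i * j *_) (^-distribʳ-* i j n)) (interchange i j (i ^ n) (j ^ n))
    where
    interchange : ∀ a b c d → a * b * (c * d) ≡ a * c * (b * d)
    interchange = ℤ-Solver.solve-∀

  pos-^ : ∀ m n → + (m ℕ.^ n) ≡ (+ m) ^ n
  pos-^ m zero = refl
  pos-^ m (suc n) = trans (ℤₚ.pos-* m (m ℕ.^ n)) (cong (+ m *_) (pos-^ m n))

  sum : ℕ → (ℕ → ℤ) → ℤ
  sum zero f = 0ℤ
  sum (suc n) f = sum n f + f n

  sum-cong< : ∀ n {f g} → (∀ i → i ℕ.< n → f i ≡ g i) → sum n f ≡ sum n g
  sum-cong< zero eq = refl
  sum-cong< (suc n) eq = cong₂ _+_ (sum-cong< n (λ i i<n → eq i (ℕₚ.m<n⇒m<1+n i<n))) (eq n ℕₚ.≤-refl)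

  sum-cong : ∀ n {f g} → (∀ i → f i ≡ g i) → sum n f ≡ sum n g
  sum-cong n eq = sum-cong< n (λ i _ → eq i)

  sum-+ : ∀ n f g → sum n (λ i → f i + g i) ≡ sum n f + sum n g
  sum-+ zero f g = refl
  sum-+ (suc n) f g = trans (cong (_+ (f n + g n)) (sum-+ n f g)) (interchange (sum n f) (sum n g) (f n) (g n))
    where
    interchange : ∀ a b c d → a + b + (c + d) ≡ a + c + (b + d)
    interchange = ℤ-Solver.solve-∀

  sum-*ˡ : ∀ n c f → sum n (λ i → c * f i) ≡ c * sum n f
  sum-*ˡ zero c f = sym (ℤₚ.*-zeroʳ c)
  sum-*ˡ (suc n) c f = trans (cong (_+ c * f n) (sum-*ˡ n c f)) (sym (ℤₚ.*-distribˡ-+ c (sum n f) (f n)))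

  sum-*ʳ : ∀ n c f → sum n (λ i → f i * c) ≡ sum n f * c
  sum-*ʳ n c f = trans (sum-cong n (λ i → ℤₚ.*-comm (f i) c)) (trans (sum-*ˡ n c f) (ℤₚ.*-comm c (sum n f)))

  sum-const : ∀ n c → sum n (λ _ → c) ≡ + n * c
  sum-const zero c = sym (ℤₚ.*-zeroˡ c)
  sum-const (suc n) c = trans (cong (_+ c) (sum-const n c)) (step (+ n) c)
    where
    step : ∀ a c → a * c + c ≡ (1ℤ + a) * c
    step = ℤ-Solver.solve-∀

  sum-0 : ∀ n → sum n (λ _ → 0ℤ) ≡ 0ℤ
  sum-0 n = trans (sum-const n 0ℤ) (ℤₚ.*-zeroʳ (+ n))

  sum-swap : ∀ m n (F : ℕ → ℕ → ℤ) →
    sum m (λ i → sum n (λ j → F i j)) ≡ sum n (λ j → sum m (λ i → F i j))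
  sum-swap zero n F = sym (sum-0 n)
  sum-swap (suc m) n F = trans (cong (_+ sum n (F m)) (sum-swap m n F))
    (sym (sum-+ n (λ j → sum m (λ i → F i j)) (F m)))

  sum-product : ∀ m n f g → sum m f * sum n g ≡ sum m (λ i → sum n (λ j → f i * g j))
  sum-product m n f g = trans (sym (sum-*ʳ m (sum n g) f)) (sum-cong m (λ i → sym (sum-*ˡ n (f i) g)))

  sum-mono< : ∀ n {f g} → (∀ i → i ℕ.< n → f i ≤ g i) → sum n f ≤ sum n g
  sum-mono< zero le = ℤₚ.≤-refl
  sum-mono< (suc n) le = ℤₚ.+-mono-≤ (sum-mono< n (λ i i<n → le i (ℕₚ.m<n⇒m<1+n i<n))) (le n ℕₚ.≤-refl)

  sum-mono : ∀ n {f g} → (∀ i → f i ≤ g i) → sum n f ≤ sum n g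
  sum-mono n le = sum-mono< n (λ i _ → le i)

  sum-nonneg : ∀ n {f} → (∀ i → 0ℤ ≤ f i) → 0ℤ ≤ sum n f
  sum-nonneg n {f} le = subst (_≤ sum n f) (sum-0 n) (sum-mono n le)

  sum-bound< : ∀ n {f} c → (∀ i → i ℕ.< n → f i ≤ c) → sum n f ≤ + n * c
  sum-bound< n {f} c le = subst (sum n f ≤_) (sum-const n c) (sum-mono< n le)

  sum-abs : ∀ n f → + ∣ sum n f ∣ ≤ sum n (λ i → + ∣ f i ∣)
  sum-abs zero f = ℤₚ.≤-refl
  sum-abs (suc n) f = begin
    + ∣ sum n f + f n ∣             ≤⟨ ℤ.+≤+ (ℤₚ.∣i+j∣≤∣i∣+∣j∣ (sum n f) (f n)) ⟩
    + (∣ sum n f ∣ ℕ.+ ∣ f n ∣)     ≡⟨ ℤₚ.pos-+ ∣ sum n f ∣ ∣ f n ∣ ⟩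
    + ∣ sum n f ∣ + + ∣ f n ∣       ≤⟨ ℤₚ.+-monoˡ-≤ (+ ∣ f n ∣) (sum-abs n f) ⟩
    sum n (λ i → + ∣ f i ∣) + + ∣ f n ∣ ∎
    where open ℤₚ.≤-Reasoning

  sum-front : ∀ n f → sum (suc n) f ≡ f 0 + sum n (λ i → f (suc i))
  sum-front zero f = ℤₚ.+-comm 0ℤ (f 0)
  sum-front (suc n) f = trans (cong (_+ f (suc n)) (sum-front n f)) (ℤₚ.+-assoc (f 0) (sum n (λ i → f (suc i))) (f (suc n)))

  sum-split : ∀ m n f → sum (m ℕ.+ n) f ≡ sum m f + sum n (λ i → f (m ℕ.+ i))
  sum-split m zero f = trans (cong (λ k → sum k f) (ℕₚ.+-identityʳ m)) (sym (ℤₚ.+-identityʳ (sum m f)))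
  sum-split m (suc n) f = trans (cong (λ k → sum k f) (ℕₚ.+-suc m n))
    (trans (cong (_+ f (m ℕ.+ n)) (sum-split m n f))
           (ℤₚ.+-assoc (sum m f) (sum n (λ i → f (m ℕ.+ i))) (f (m ℕ.+ n))))

  sum-reverse : ∀ n f → sum (suc n) (λ i → f (n ∸ i)) ≡ sum (suc n) f
  sum-reverse zero f = refl
  sum-reverse (suc n) f = begin
    sum (suc (suc n)) (λ i → f (suc n ∸ i))      ≡⟨ sum-front (suc n) (λ i → f (suc n ∸ i)) ⟩
    f (suc n) + sum (suc n) (λ i → f (n ∸ i))    ≡⟨ cong (λ s → f (suc n) + s) (sum-reverse n f) ⟩
    f (suc n) + sum (suc n) f                    ≡⟨ ℤₚ.+-comm (f (suc n)) (sum (suc n) f) ⟩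
    sum (suc (suc n)) f ∎
    where open ≡-Reasoning

  -- Expanding the nonnegative sum of the squares (n f i - S)² gives n (n Q - S²). Scaling by n
  -- instead of subtracting the mean S / n keeps all terms integral.
  cauchy-schwarz : ∀ n f → sum n f * sum n f ≤ + n * sum n (λ i → f i * f i)
  cauchy-schwarz zero f = ℤₚ.≤-refl
  cauchy-schwarz n@(suc _) f = ℤₚ.0≤i-j⇒j≤i (ℤₚ.*-cancelˡ-≤-pos 0ℤ (+ n * Q - S * S) (+ n)
    (subst₂ _≤_ (sym (ℤₚ.*-zeroʳ (+ n))) expand (sum-nonneg n (λ i → 0≤square (+ n * f i - S)))))
    where
    S = sum n f
    Q = sum n (λ i → f i * f i)
    square-expand : ∀ a b c → (a * b - c) * (a * b - c) ≡ a * a * (b * b) + (- (a * c + a * c) * b + c * c)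
    square-expand = ℤ-Solver.solve-∀
    collect : ∀ a q s → a * a * q + (- (a * s + a * s) * s + a * (s * s)) ≡ a * (a * q - s * s)
    collect = ℤ-Solver.solve-∀
    open ≡-Reasoning
    expand : sum n (λ i → (+ n * f i - S) * (+ n * f i - S)) ≡ + n * (+ n * Q - S * S)
    expand = begin
      sum n (λ i → (+ n * f i - S) * (+ n * f i - S))
        ≡⟨ sum-cong n (λ i → square-expand (+ n) (f i) S) ⟩
      sum n (λ i → + n * + n * (f i * f i) + (- (+ n * S + + n * S) * f i + S * S))
        ≡⟨ sum-+ n _ _ ⟩
      sum n (λ i → + n * + n * (f i * f i)) + sum n (λ i → - (+ n * S + + n * S) * f i + S * S)
        ≡⟨ cong₂ _+_ (sum-*ˡ n (+ n * + n) _)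
             (trans (sum-+ n _ _) (cong₂ _+_ (sum-*ˡ n (- (+ n * S + + n * S)) f) (sum-const n (S * S)))) ⟩
      + n * + n * Q + (- (+ n * S + + n * S) * S + + n * (S * S))
        ≡⟨ collect (+ n) Q S ⟩
      + n * (+ n * Q - S * S) ∎

  indicator : Bool → ℤ
  indicator b = if b then 1ℤ else 0ℤ

  indicator-≢ : ∀ {a b} → a ≢ b → ∀ i → indicator (a ℕ.≡ᵇ b) * i ≡ 0ℤ
  indicator-≢ {a} {b} a≢b i with a ℕ.≡ᵇ b in eq
  ... | false = ℤₚ.*-zeroˡ i
  ... | true = ⊥-elim (a≢b (ℕₚ.≡ᵇ⇒≡ a b (subst T (sym eq) _)))

  ≡ᵇ-refl : ∀ a → (a ℕ.≡ᵇ a) ≡ true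
  ≡ᵇ-refl zero = refl
  ≡ᵇ-refl (suc a) = ≡ᵇ-refl a

  sum-δ : ∀ n s (f : ℕ → ℤ) → s ℕ.< n → sum n (λ m → indicator (s ℕ.≡ᵇ m) * f m) ≡ f s
  sum-δ (suc n) s f s<1+n with ℕₚ.m≤n⇒m<n∨m≡n (ℕₚ.≤-pred s<1+n)
  ... | inj₁ s<n = trans (cong₂ _+_ (sum-δ n s f s<n) (indicator-≢ (ℕₚ.<⇒≢ s<n) (f n))) (ℤₚ.+-identityʳ (f s))
  ... | inj₂ refl = trans
    (cong₂ _+_
      (trans (sum-cong< s (λ m m<s → indicator-≢ (ℕₚ.>⇒≢ m<s) (f m))) (sum-0 s))
      (trans (cong (λ b → indicator b * f s) (≡ᵇ-refl s)) (ℤₚ.*-identityˡ (f s))))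
    (ℤₚ.+-identityˡ (f s))

open IntegerSums

-- Correlations of functions of period `N`.

module Cyclic (N : ℕ) where
  open import Data.Integer using (_+_; _*_; _≤_)

  Periodic : (ℕ → ℤ) → Set
  Periodic v = ∀ x → v (x ℕ.+ N) ≡ v x

  shift : ∀ t {v} → Periodic v → Periodic (λ x → v (t ℕ.+ x))
  shift t {v} per x = trans (cong v (sym (ℕₚ.+-assoc t x N))) (per (t ℕ.+ x))

  sum-suc : ∀ {v} → Periodic v → sum N (λ x → v (suc x)) ≡ sum N v
  sum-suc {v} per = ℤ+.∙-cancelˡ (v 0) _ _ (trans (sym (sum-front N v))
    (trans (cong (λ i → sum N v + i) (per 0)) (ℤₚ.+-comm (sum N v) (v 0))))

  sum-shift : ∀ t {v} → Periodic v → sum N (λ x → v (t ℕ.+ x)) ≡ sum N v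
  sum-shift zero per = refl
  sum-shift (suc t) per = trans (sum-shift t (λ x → per (suc x))) (sum-suc per)

  sum-square : ∀ h (a : ℕ → ℤ) (F : ℕ → ℕ → ℤ) →
    sum N (λ x → sum h (λ m → a m * F m x) * sum h (λ m → a m * F m x))
      ≡ sum h (λ m → sum h (λ m′ → a m * a m′ * sum N (λ x → F m x * F m′ x)))
  sum-square h a F = begin
    sum N (λ x → sum h (λ m → a m * F m x) * sum h (λ m → a m * F m x))
      ≡⟨ sum-cong N (λ x → sum-product h h _ _) ⟩
    sum N (λ x → sum h (λ m → sum h (λ m′ → a m * F m x * (a m′ * F m′ x))))
      ≡⟨ sum-swap N h _ ⟩
    sum h (λ m → sum N (λ x → sum h (λ m′ → a m * F m x * (a m′ * F m′ x))))
      ≡⟨ sum-cong h (λ m → sum-swap N h _) ⟩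
    sum h (λ m → sum h (λ m′ → sum N (λ x → a m * F m x * (a m′ * F m′ x))))
      ≡⟨ sum-cong h (λ m → sum-cong h (λ m′ → trans
           (sum-cong N (λ x → interchange (a m) (F m x) (a m′) (F m′ x)))
           (sum-*ˡ N (a m * a m′) _))) ⟩
    sum h (λ m → sum h (λ m′ → a m * a m′ * sum N (λ x → F m x * F m′ x))) ∎
    where
    open ≡-Reasoning
    interchange : ∀ a b c d → a * b * (c * d) ≡ a * c * (b * d)
    interchange = ℤ-Solver.solve-∀

  corr : (ℕ → ℤ) → ℕ → ℕ → ℤ
  corr w s t = sum N (λ x → w (s ℕ.+ x) * w (t ℕ.+ x))

  corr-comm : ∀ w s t → corr w s t ≡ corr w t s
  corr-comm w s t = sum-cong N (λ x → ℤₚ.*-comm (w (s ℕ.+ x)) (w (t ℕ.+ x)))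

  module _ {w : ℕ → ℤ} (per : Periodic w) where

    corr-shift : ∀ k s t → corr w (k ℕ.+ s) (k ℕ.+ t) ≡ corr w s t
    corr-shift k s t = trans
      (sum-cong N (λ x → cong₂ _*_ (cong w (rotate k s x)) (cong w (rotate k t x))))
      (sum-shift k (λ x → cong₂ _*_ (shift s per x) (shift t per x)))
      where
      rotate : ∀ k s x → k ℕ.+ s ℕ.+ x ≡ s ℕ.+ (k ℕ.+ x)
      rotate = ℕ-Solver.solve-∀

    -- For periodic `w` only the lag s - t matters. The hypothesis is s - t = s′ - t′ without
    -- subtraction: shifting the first pair by t′ and the second by t makes them coincide.
    corr-≡ : ∀ s t s′ t′ → s ℕ.+ t′ ≡ s′ ℕ.+ t → corr w s t ≡ corr w s′ t′
    corr-≡ s t s′ t′ eq = trans (sym (corr-shift t′ s t)) (trans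
      (cong₂ (corr w) (trans (ℕₚ.+-comm t′ s) (trans eq (ℕₚ.+-comm s′ t))) (ℕₚ.+-comm t′ t))
      (corr-shift t s′ t′))

  -- The quadratic form behind the argument: positivity of ‖Σ_a w(· + a(m - m′))‖² for all m, m′
  -- is averaged against the weights c, and compared with the same sum grouped by q = |a - b|.
  module Positivity {w : ℕ → ℤ} (per : Periodic w) (h Q : ℕ) (c : ℕ → ℤ) (0≤c : ∀ m → 0ℤ ≤ c m) where

    energy : ℤ
    energy = corr w 0 0

    0≤energy : 0ℤ ≤ energy
    0≤energy = sum-nonneg N (λ x → 0≤square (w x))

    -- When `c` counts the representations as a sum of p elements of [0, L), this is ‖P_qᵖ w‖²
    -- before normalisation.
    smoothed : ℕ → ℤ
    smoothed q = sum N (λ x → sum h (λ m → c m * w (q ℕ.* m ℕ.+ x)) * sum h (λ m → c m * w (q ℕ.* m ℕ.+ x)))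

    smoothed-expand : ∀ q → smoothed q ≡ sum h (λ m → sum h (λ m′ → c m * c m′ * corr w (q ℕ.* m) (q ℕ.* m′)))
    smoothed-expand q = sum-square h c (λ m x → w (q ℕ.* m ℕ.+ x))

    smoothed-0 : smoothed 0 ≡ sum h c * sum h c * energy
    smoothed-0 = trans (smoothed-expand 0) (trans
      (sum-cong h (λ m → sum-*ʳ h energy _))
      (trans (sum-*ʳ h energy _) (cong (_* energy) (sym (sum-product h h c c)))))

    -- The lag is (a - b)(m - m′), multiplied out, with the negative terms moved to the second
    -- argument.
    cross : ℕ → ℕ → ℕ → ℕ → ℤ
    cross a b m m′ = corr w (a ℕ.* m ℕ.+ b ℕ.* m′) (a ℕ.* m′ ℕ.+ b ℕ.* m)

    block : ℕ → ℕ → ℤ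
    block m m′ = sum Q (λ a → sum Q (λ b → cross a b m m′))

    block-diagonal : ∀ m → block m m ≡ + Q * (+ Q * energy)
    block-diagonal m = trans
      (sum-cong Q (λ a → trans
        (sum-cong Q (λ b → corr-≡ per (a ℕ.* m ℕ.+ b ℕ.* m) (a ℕ.* m ℕ.+ b ℕ.* m) 0 0
          (ℕₚ.+-comm (a ℕ.* m ℕ.+ b ℕ.* m) 0)))
        (sum-const Q energy)))
      (sum-const Q (+ Q * energy))

    0≤block : ∀ m m′ → 0ℤ ≤ block m m′
    0≤block m m′ = subst (0ℤ ≤_) eq (sum-nonneg N (λ x → 0≤square (sum Q (λ a → 1ℤ * w (σ a ℕ.+ x)))))
      where
      σ : ℕ → ℕ
      -- This is a (m - m′) + Q m′: the common translation by Q m′ makes the shift a natural number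
      -- and leaves the norm unchanged.
      σ a = a ℕ.* m ℕ.+ (Q ∸ a) ℕ.* m′
      move : ∀ a a′ b b′ → a ℕ.+ a′ ≡ b ℕ.+ b′ →
        a ℕ.* m ℕ.+ a′ ℕ.* m′ ℕ.+ (a ℕ.* m′ ℕ.+ b ℕ.* m) ≡ a ℕ.* m ℕ.+ b ℕ.* m′ ℕ.+ (b ℕ.* m ℕ.+ b′ ℕ.* m′)
      move a a′ b b′ e = trans (lhs a a′ b m m′) (trans (cong (λ k → a ℕ.* m ℕ.+ b ℕ.* m ℕ.+ k ℕ.* m′) e) (rhs a b b′ m m′))
        where
        lhs : ∀ a a′ b m m′ → a ℕ.* m ℕ.+ a′ ℕ.* m′ ℕ.+ (a ℕ.* m′ ℕ.+ b ℕ.* m) ≡ a ℕ.* m ℕ.+ b ℕ.* m ℕ.+ (a ℕ.+ a′) ℕ.* m′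
        lhs = ℕ-Solver.solve-∀
        rhs : ∀ a b b′ m m′ → a ℕ.* m ℕ.+ b ℕ.* m ℕ.+ (b ℕ.+ b′) ℕ.* m′ ≡ a ℕ.* m ℕ.+ b ℕ.* m′ ℕ.+ (b ℕ.* m ℕ.+ b′ ℕ.* m′)
        rhs = ℕ-Solver.solve-∀
      eq : sum N (λ x → sum Q (λ a → 1ℤ * w (σ a ℕ.+ x)) * sum Q (λ a → 1ℤ * w (σ a ℕ.+ x))) ≡ block m m′
      eq = trans (sum-square Q (λ _ → 1ℤ) (λ a x → w (σ a ℕ.+ x)))
        (sum-cong< Q (λ a a<Q → sum-cong< Q (λ b b<Q → trans (ℤₚ.*-identityˡ (corr w (σ a) (σ b)))
          (corr-≡ per (σ a) (σ b) (a ℕ.* m ℕ.+ b ℕ.* m′) (a ℕ.* m′ ℕ.+ b ℕ.* m)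
            (move a (Q ∸ a) b (Q ∸ b) (trans (ℕₚ.m+[n∸m]≡n (ℕₚ.<⇒≤ a<Q)) (sym (ℕₚ.m+[n∸m]≡n (ℕₚ.<⇒≤ b<Q)))))))))

    total : ℤ
    total = sum h (λ m → sum h (λ m′ → c m * c m′ * block m m′))

    sum-single : ∀ n i {f} → (∀ j → 0ℤ ≤ f j) → i ℕ.< n → f i ≤ sum n f
    sum-single n i {f} 0≤f i<n = subst (_≤ sum n f) (sum-δ n i f i<n) (sum-mono n term)
      where
      term : ∀ m → indicator (i ℕ.≡ᵇ m) * f m ≤ f m
      term m with i ℕ.≡ᵇ m
      ... | true = ℤₚ.≤-reflexive (ℤₚ.*-identityˡ (f m))
      ... | false = subst (_≤ f m) (sym (ℤₚ.*-zeroˡ (f m))) (0≤f m)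

    -- All terms are nonnegative by `0≤block` and `0≤c`, so it suffices to keep m = m′, where the
    -- block is Q² times the energy.
    total-lower : sum h (λ m → c m * c m) * (+ Q * (+ Q * energy)) ≤ total
    total-lower = subst (_≤ total) (sum-*ʳ h (+ Q * (+ Q * energy)) (λ m → c m * c m)) (sum-mono< h (λ m m<h →
      subst (_≤ sum h (λ m′ → c m * c m′ * block m m′)) (cong (c m * c m *_) (block-diagonal m))
        (sum-single h m (λ m′ → 0≤*0≤ (0≤*0≤ (0≤c m) (0≤c m′)) (0≤block m m′)) m<h)))

    slice : ℕ → ℕ → ℤ
    slice a b = sum h (λ m → sum h (λ m′ → c m * c m′ * cross a b m m′))

    total-slices : total ≡ sum Q (λ a → sum Q (λ b → slice a b))
    total-slices = begin
      sum h (λ m → sum h (λ m′ → c m * c m′ * block m m′))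
        ≡⟨ sum-cong h (λ m → sum-cong h (λ m′ → trans (sym (sum-*ˡ Q (c m * c m′) _))
             (sum-cong Q (λ a → sym (sum-*ˡ Q (c m * c m′) _))))) ⟩
      sum h (λ m → sum h (λ m′ → sum Q (λ a → sum Q (λ b → c m * c m′ * cross a b m m′))))
        ≡⟨ sum-cong h (λ m → sum-swap h Q _) ⟩
      sum h (λ m → sum Q (λ a → sum h (λ m′ → sum Q (λ b → c m * c m′ * cross a b m m′))))
        ≡⟨ sum-swap h Q _ ⟩
      sum Q (λ a → sum h (λ m → sum h (λ m′ → sum Q (λ b → c m * c m′ * cross a b m m′))))
        ≡⟨ sum-cong Q (λ a → trans (sum-cong h (λ m → sum-swap h Q _)) (sum-swap h Q _)) ⟩
      sum Q (λ a → sum Q (λ b → slice a b)) ∎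
      where open ≡-Reasoning

    -- With b = a + q the lag is q (m′ - m), which no longer contains a. Hence all pairs at the same
    -- distance contribute alike.
    slice-≤ : ∀ a q → slice a (a ℕ.+ q) ≡ smoothed q
    slice-≤ a q = trans
      (sum-cong h (λ m → sum-cong h (λ m′ → cong (c m * c m′ *_) (trans
        (corr-≡ per _ _ (q ℕ.* m′) (q ℕ.* m) (cancel a q m m′)) (corr-comm w (q ℕ.* m′) (q ℕ.* m))))))
      (sym (smoothed-expand q))
      where
      cancel : ∀ a q m m′ → a ℕ.* m ℕ.+ (a ℕ.+ q) ℕ.* m′ ℕ.+ q ℕ.* m ≡ q ℕ.* m′ ℕ.+ (a ℕ.* m′ ℕ.+ (a ℕ.+ q) ℕ.* m)
      cancel = ℕ-Solver.solve-∀

    slice-≥ : ∀ b q → slice (b ℕ.+ q) b ≡ smoothed q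
    slice-≥ b q = trans
      (sum-cong h (λ m → sum-cong h (λ m′ → cong (c m * c m′ *_)
        (corr-≡ per _ _ (q ℕ.* m) (q ℕ.* m′) (cancel b q m m′)))))
      (sym (smoothed-expand q))
      where
      cancel : ∀ b q m m′ → (b ℕ.+ q) ℕ.* m ℕ.+ b ℕ.* m′ ℕ.+ q ℕ.* m′ ≡ q ℕ.* m ℕ.+ ((b ℕ.+ q) ℕ.* m′ ℕ.+ b ℕ.* m)
      cancel = ℕ-Solver.solve-∀

    module _ (e M : ℤ) (0≤e : 0ℤ ≤ e) (0≤M : 0ℤ ≤ M)
      (bound : ∀ q → 0 ℕ.< q → q ℕ.< Q → e * smoothed q ≤ M) where

      D : ℤ
      D = e * (sum h c * sum h c * energy)

      slice-bound : ∀ a b → a ℕ.< Q → b ℕ.< Q → e * slice a b ≤ indicator (a ℕ.≡ᵇ b) * D + M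
      slice-bound a b a<Q b<Q with ℕₚ.<-cmp a b
      ... | tri< a<b a≢b _ = subst₂ _≤_
        (cong (e *_) (trans (sym (slice-≤ a (b ∸ a))) (cong (slice a) (ℕₚ.m+[n∸m]≡n (ℕₚ.<⇒≤ a<b)))))
        (sym (trans (cong (_+ M) (indicator-≢ a≢b D)) (ℤₚ.+-identityˡ M)))
        (bound (b ∸ a) (ℕₚ.m<n⇒0<n∸m a<b) (ℕₚ.≤-<-trans (ℕₚ.m∸n≤m b a) b<Q))
      ... | tri> _ a≢b b<a = subst₂ _≤_
        (cong (e *_) (trans (sym (slice-≥ b (a ∸ b))) (cong (λ k → slice k b) (ℕₚ.m+[n∸m]≡n (ℕₚ.<⇒≤ b<a)))))
        (sym (trans (cong (_+ M) (indicator-≢ a≢b D)) (ℤₚ.+-identityˡ M)))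
        (bound (a ∸ b) (ℕₚ.m<n⇒0<n∸m b<a) (ℕₚ.≤-<-trans (ℕₚ.m∸n≤m a b) a<Q))
      ... | tri≈ _ refl _ = subst₂ _≤_
        (trans (ℤₚ.+-identityʳ D) (cong (e *_) (trans (sym smoothed-0) (trans (sym (slice-≤ a 0)) (cong (slice a) (ℕₚ.+-identityʳ a))))))
        (cong (_+ M) (sym (trans (cong (λ t → indicator t * D) (≡ᵇ-refl a)) (ℤₚ.*-identityˡ D))))
        (ℤₚ.+-monoʳ-≤ D 0≤M)

      total-upper : e * total ≤ + Q * (D + + Q * M)
      total-upper = subst (_≤ + Q * (D + + Q * M))
        (trans (sum-cong Q (λ a → sum-*ˡ Q e (slice a))) (trans (sum-*ˡ Q e _) (cong (e *_) (sym total-slices))))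
        (sum-bound< Q (D + + Q * M) (λ a a<Q → ℤₚ.≤-trans
          (sum-mono< Q (λ b b<Q → slice-bound a b a<Q b<Q))
          (ℤₚ.≤-reflexive (trans (sum-+ Q _ _) (cong₂ _+_ (sum-δ Q a (λ _ → D) a<Q) (sum-const Q M))))))

      -- Divided by e Q², this reads Σc² · energy ≤ (Σc)² · energy / Q + M / e. As Σc² ≥ (Σc)² / h,
      -- taking Q larger than h forces the bound M / e on the `smoothed q` with q ≠ 0 to be large.
      positivity : e * (sum h (λ m → c m * c m) * (+ Q * (+ Q * energy))) ≤ + Q * (D + + Q * M)
      positivity = ℤₚ.≤-trans (*-monoˡ 0≤e total-lower) total-upper

-- Sums over k-fold sums of an interval, with multiplicity.

module BoxSums where
  open import Data.Integer using (_*_; _≤_; _^_)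

  -- `F` is paired with the k-fold convolution power of the interval [0, L); this amounts to k
  -- successive interval averages, before normalisation.
  boxSum : ℕ → ℕ → (ℕ → ℤ) → ℤ
  boxSum L zero F = F 0
  boxSum L (suc k) F = sum L (λ i → boxSum L k (λ s → F (i ℕ.+ s)))

  boxSum-cong< : ∀ ℓ k {F G} → (∀ s → s ℕ.≤ k ℕ.* ℓ → F s ≡ G s) → boxSum (suc ℓ) k F ≡ boxSum (suc ℓ) k G
  boxSum-cong< ℓ zero eq = eq 0 ℕ.z≤n
  boxSum-cong< ℓ (suc k) eq = sum-cong< (suc ℓ) (λ i i≤ℓ → boxSum-cong< ℓ k (λ s s≤ → eq (i ℕ.+ s) (ℕₚ.+-mono-≤ (ℕₚ.≤-pred i≤ℓ) s≤)))

  boxSum-cong : ∀ L k {F G} → (∀ s → F s ≡ G s) → boxSum L k F ≡ boxSum L k G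
  boxSum-cong L zero eq = eq 0
  boxSum-cong L (suc k) eq = sum-cong L (λ i → boxSum-cong L k (λ s → eq (i ℕ.+ s)))

  boxSum-nonneg : ∀ L k {F} → (∀ s → 0ℤ ≤ F s) → 0ℤ ≤ boxSum L k F
  boxSum-nonneg L zero le = le 0
  boxSum-nonneg L (suc k) le = sum-nonneg L (λ i → boxSum-nonneg L k (λ s → le (i ℕ.+ s)))

  boxSum-1 : ∀ L k → boxSum L k (λ _ → 1ℤ) ≡ (+ L) ^ k
  boxSum-1 L zero = refl
  boxSum-1 L (suc k) = trans (sum-cong L (λ _ → boxSum-1 L k)) (sum-const L ((+ L) ^ k))

  boxSum-*ˡ : ∀ L k c F → boxSum L k (λ s → c * F s) ≡ c * boxSum L k F
  boxSum-*ˡ L zero c F = refl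
  boxSum-*ˡ L (suc k) c F = trans (sum-cong L (λ i → boxSum-*ˡ L k c (λ s → F (i ℕ.+ s)))) (sum-*ˡ L c _)

  boxSum-sum : ∀ L k n (F : ℕ → ℕ → ℤ) →
    boxSum L k (λ s → sum n (λ i → F i s)) ≡ sum n (λ i → boxSum L k (F i))
  boxSum-sum L zero n F = refl
  boxSum-sum L (suc k) n F = trans (sum-cong L (λ i → boxSum-sum L k n (λ j s → F j (i ℕ.+ s)))) (sum-swap L n _)

  -- Reversing every summand, i to ℓ - i, sends a sum s to kℓ - s.
  boxSum-reverse : ∀ ℓ k F → boxSum (suc ℓ) k (λ s → F (k ℕ.* ℓ ∸ s)) ≡ boxSum (suc ℓ) k F
  boxSum-reverse ℓ zero F = refl
  boxSum-reverse ℓ (suc k) F = begin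
    sum (suc ℓ) (λ i → boxSum (suc ℓ) k (λ s → F (ℓ ℕ.+ k ℕ.* ℓ ∸ (i ℕ.+ s))))
      ≡⟨ sum-cong< (suc ℓ) (λ i i≤ℓ → boxSum-cong< ℓ k (λ s s≤ → cong F (split i s (ℕₚ.≤-pred i≤ℓ) s≤))) ⟩
    sum (suc ℓ) (λ i → boxSum (suc ℓ) k (λ s → F (ℓ ∸ i ℕ.+ (k ℕ.* ℓ ∸ s))))
      ≡⟨ sum-cong (suc ℓ) (λ i → boxSum-reverse ℓ k (λ s → F (ℓ ∸ i ℕ.+ s))) ⟩
    sum (suc ℓ) (λ i → boxSum (suc ℓ) k (λ s → F (ℓ ∸ i ℕ.+ s)))
      ≡⟨ sum-reverse ℓ (λ j → boxSum (suc ℓ) k (λ s → F (j ℕ.+ s))) ⟩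
    boxSum (suc ℓ) (suc k) F ∎
    where
    open ≡-Reasoning
    split : ∀ i s → i ℕ.≤ ℓ → s ℕ.≤ k ℕ.* ℓ → ℓ ℕ.+ k ℕ.* ℓ ∸ (i ℕ.+ s) ≡ ℓ ∸ i ℕ.+ (k ℕ.* ℓ ∸ s)
    split i s i≤ℓ s≤ = trans (sym (ℕₚ.∸-+-assoc (ℓ ℕ.+ k ℕ.* ℓ) i s))
      (trans (cong (_∸ s) (ℕₚ.+-∸-comm (k ℕ.* ℓ) i≤ℓ)) (ℕₚ.+-∸-assoc (ℓ ∸ i) s≤))

  multiplicity : ℕ → ℕ → ℕ → ℤ
  multiplicity L k m = boxSum L k (λ s → indicator (s ℕ.≡ᵇ m))

  0≤multiplicity : ∀ L k m → 0ℤ ≤ multiplicity L k m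
  0≤multiplicity L k m = boxSum-nonneg L k (λ s → 0≤indicator (s ℕ.≡ᵇ m))
    where
    0≤indicator : ∀ b → 0ℤ ≤ indicator b
    0≤indicator true = ℤ.+≤+ ℕ.z≤n
    0≤indicator false = ℤ.+≤+ ℕ.z≤n

  -- Tuples are collected by their sum, which never exceeds kℓ. This links the iterated sums, suited
  -- to induction on k, with the single weights `c` of `Positivity`.
  boxSum-multiplicity : ∀ ℓ k F → sum (suc (k ℕ.* ℓ)) (λ m → multiplicity (suc ℓ) k m * F m) ≡ boxSum (suc ℓ) k F
  boxSum-multiplicity ℓ k F = begin
    sum (suc (k ℕ.* ℓ)) (λ m → multiplicity (suc ℓ) k m * F m)
      ≡⟨ sum-cong (suc (k ℕ.* ℓ)) (λ m → trans (ℤₚ.*-comm (multiplicity (suc ℓ) k m) (F m))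
           (sym (boxSum-*ˡ (suc ℓ) k (F m) (λ s → indicator (s ℕ.≡ᵇ m))))) ⟩
    sum (suc (k ℕ.* ℓ)) (λ m → boxSum (suc ℓ) k (λ s → F m * indicator (s ℕ.≡ᵇ m)))
      ≡⟨ boxSum-sum (suc ℓ) k (suc (k ℕ.* ℓ)) (λ m s → F m * indicator (s ℕ.≡ᵇ m)) ⟨
    boxSum (suc ℓ) k (λ s → sum (suc (k ℕ.* ℓ)) (λ m → F m * indicator (s ℕ.≡ᵇ m)))
      ≡⟨ boxSum-cong< ℓ k (λ s s≤ → trans (sum-cong (suc (k ℕ.* ℓ)) (λ m → ℤₚ.*-comm (F m) (indicator (s ℕ.≡ᵇ m))))
           (sum-δ (suc (k ℕ.* ℓ)) s F (ℕ.s≤s s≤))) ⟩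
    boxSum (suc ℓ) k F ∎
    where open ≡-Reasoning

  sum-multiplicity : ∀ ℓ k → sum (suc (k ℕ.* ℓ)) (multiplicity (suc ℓ) k) ≡ (+ suc ℓ) ^ k
  sum-multiplicity ℓ k = trans
    (sum-cong (suc (k ℕ.* ℓ)) (λ m → sym (ℤₚ.*-identityʳ (multiplicity (suc ℓ) k m))))
    (trans (boxSum-multiplicity ℓ k (λ _ → 1ℤ)) (boxSum-1 (suc ℓ) k))

-- Hankel operators, their powers, and averages along progressions.

module Hankel (N : ℕ) where
  open import Data.Integer using (∣_∣; _+_; _*_; _≤_; _^_)
  open Cyclic N
  open BoxSums

  hankel : (ℕ → ℤ) → (ℕ → ℤ) → ℕ → ℤ
  hankel g v x = sum N (λ y → g (x ℕ.+ y) * v y)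

  hankel-periodic : ∀ {g} v → Periodic g → Periodic (hankel g v)
  hankel-periodic {g} v per x = sum-cong N (λ y → cong (_* v y) (trans (cong g (swap x N y)) (per (x ℕ.+ y))))
    where
    swap : ∀ x n y → x ℕ.+ n ℕ.+ y ≡ x ℕ.+ y ℕ.+ n
    swap = ℕ-Solver.solve-∀

  inner : (ℕ → ℤ) → (ℕ → ℤ) → ℤ
  inner u v = sum N (λ x → u x * v x)

  hankel-symmetric : ∀ g u v → inner u (hankel g v) ≡ inner (hankel g u) v
  hankel-symmetric g u v = begin
    sum N (λ x → u x * sum N (λ y → g (x ℕ.+ y) * v y))
      ≡⟨ sum-cong N (λ x → sym (sum-*ˡ N (u x) _)) ⟩
    sum N (λ x → sum N (λ y → u x * (g (x ℕ.+ y) * v y)))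
      ≡⟨ sum-swap N N _ ⟩
    sum N (λ y → sum N (λ x → u x * (g (x ℕ.+ y) * v y)))
      ≡⟨ sum-cong N (λ y → trans
           (sum-cong N (λ x → trans (rearrange (u x) (g (x ℕ.+ y)) (v y)) (cong (λ k → g k * u x * v y) (ℕₚ.+-comm x y))))
           (sum-*ʳ N (v y) _)) ⟩
    sum N (λ y → hankel g u y * v y) ∎
    where
    open ≡-Reasoning
    rearrange : ∀ a b c → a * (b * c) ≡ b * a * c
    rearrange = ℤ-Solver.solve-∀

  power : (ℕ → ℤ) → (ℕ → ℤ) → ℕ → ℕ → ℤ
  power g u zero = u
  power g u (suc k) = hankel g (power g u k)

  power-periodic : ∀ {g u} → Periodic g → Periodic u → ∀ k → Periodic (power g u k)
  power-periodic pg pu zero = pu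
  power-periodic {g} {u} pg pu (suc k) = hankel-periodic (power g u k) pg

  inner-power : ∀ g u i j → inner u (power g u (i ℕ.+ j)) ≡ inner (power g u i) (power g u j)
  inner-power g u zero j = refl
  inner-power g u (suc i) j = trans (cong (λ k → inner u (power g u k)) (sym (ℕₚ.+-suc i j)))
    (trans (inner-power g u i (suc j)) (hankel-symmetric g (power g u i) (power g u j)))

  module _ {g u : ℕ → ℤ} (∣u∣≤1 : ∀ x → + ∣ u x ∣ ≤ 1ℤ) where

    inner-square : ∀ v → inner u v * inner u v ≤ + N * inner v v
    inner-square v = ℤₚ.≤-trans (cauchy-schwarz N (λ x → u x * v x))
      (*-monoˡ {k = + N} (ℤ.+≤+ ℕ.z≤n) (sum-mono N (λ x → subst₂ _≤_ (eq x) (ℤₚ.*-identityˡ (v x * v x))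
        (*-mono-≤ (0≤square (u x)) (u²≤1 x) (0≤square (v x)) ℤₚ.≤-refl))))
      where
      u²≤1 : ∀ x → u x * u x ≤ 1ℤ
      u²≤1 x = subst (_≤ 1ℤ) (+∣∣-square (u x)) (*-mono-≤ (ℤ.+≤+ ℕ.z≤n) (∣u∣≤1 x) (ℤ.+≤+ ℕ.z≤n) (∣u∣≤1 x))
      interchange : ∀ a b → a * a * (b * b) ≡ a * b * (a * b)
      interchange = ℤ-Solver.solve-∀
      eq : ∀ x → u x * u x * (v x * v x) ≡ u x * v x * (u x * v x)
      eq x = interchange (u x) (v x)

    -- Squaring the hypothesis gives N^(2i+2) ≤ E^(2m) B²; by Cauchy-Schwarz B² is at most N ⟨v, v⟩,
    -- and one factor N cancels.
    energy-step : 0 ℕ.< N → ∀ E → 0ℤ ≤ E → ∀ m i {B} →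
      (+ N) ^ suc i ≤ E ^ m * + ∣ B ∣ → ∀ v → B ≡ inner u v →
      (+ N) ^ suc (i ℕ.+ i) ≤ E ^ (m ℕ.+ m) * inner v v
    energy-step 0<N E 0≤E m i {B} hyp v refl =
      ℤₚ.*-cancelˡ-≤-pos _ _ (+ N) {{ℤ.positive (ℤ.+<+ 0<N)}} (begin
        + N * (+ N) ^ suc (i ℕ.+ i)         ≡⟨ cong (λ t → + N * (+ N * t)) (ℤₚ.^-distribˡ-+-* (+ N) i i) ⟩
        + N * (+ N * ((+ N) ^ i * (+ N) ^ i)) ≡⟨ regroup₁ (+ N) ((+ N) ^ i) ⟩
        (+ N) ^ suc i * (+ N) ^ suc i       ≤⟨ *-mono-≤ 0≤Nⁱ hyp 0≤Nⁱ hyp ⟩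
        E ^ m * + ∣ B ∣ * (E ^ m * + ∣ B ∣) ≡⟨ regroup₂ (E ^ m) (+ ∣ B ∣) ⟩
        E ^ m * E ^ m * (+ ∣ B ∣ * + ∣ B ∣) ≡⟨ cong₂ _*_ (sym (ℤₚ.^-distribˡ-+-* E m m)) (+∣∣-square B) ⟩
        E ^ (m ℕ.+ m) * (B * B)             ≤⟨ *-monoˡ (0≤^ (m ℕ.+ m) 0≤E) (inner-square v) ⟩
        E ^ (m ℕ.+ m) * (+ N * inner v v)   ≡⟨ regroup₃ (E ^ (m ℕ.+ m)) (+ N) (inner v v) ⟩
        + N * (E ^ (m ℕ.+ m) * inner v v)   ∎)
      where
      open ℤₚ.≤-Reasoning
      0≤Nⁱ : 0ℤ ≤ (+ N) ^ suc i
      0≤Nⁱ = 0≤^ (suc i) (ℤ.+≤+ ℕ.z≤n)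
      regroup₁ : ∀ n t → n * (n * (t * t)) ≡ n * t * (n * t)
      regroup₁ = ℤ-Solver.solve-∀
      regroup₂ : ∀ e b → e * b * (e * b) ≡ e * e * (b * b)
      regroup₂ = ℤ-Solver.solve-∀
      regroup₃ : ∀ e n b → e * (n * b) ≡ n * (e * b)
      regroup₃ = ℤ-Solver.solve-∀

    -- Power iteration: G is self-adjoint, so ⟨Gᵖu, Gᵖu⟩ = ⟨u, G²ᵖu⟩ and each use of `energy-step`
    -- doubles p. The outcome is ‖Gᵖu‖² ≥ N (N²/E)^(2p), with no constant lost as p grows.
    energy-growth : 0 ℕ.< N → ∀ E → 0ℤ ≤ E → (+ N) ^ 3 ≤ E * + ∣ inner u (hankel g u) ∣ → ∀ j → let p = 2 ℕ.^ j in
      (+ N) ^ suc (p ℕ.+ p ℕ.+ (p ℕ.+ p)) ≤ E ^ (p ℕ.+ p) * inner (power g u p) (power g u p)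
    energy-growth 0<N E 0≤E base j = energy-step 0<N E 0≤E (2 ℕ.^ j) (2 ℕ.^ j ℕ.+ 2 ℕ.^ j) (lower j) (power g u (2 ℕ.^ j)) refl
      where
      lower : ∀ j → let p = 2 ℕ.^ j in
        (+ N) ^ suc (p ℕ.+ p) ≤ E ^ p * + ∣ inner u (power g u p) ∣
      lower zero = subst (λ e → (+ N) ^ 3 ≤ e * + ∣ inner u (hankel g u) ∣) (sym (ℤₚ.^-identityʳ E)) base
      lower (suc j) = subst (λ q → (+ N) ^ suc (q ℕ.+ q) ≤ E ^ q * + ∣ inner u (power g u q) ∣) double
        (ℤₚ.≤-trans
          (subst (λ b → (+ N) ^ suc (p ℕ.+ p ℕ.+ (p ℕ.+ p)) ≤ E ^ (p ℕ.+ p) * b) (sym (inner-power g u p p))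
            (energy-step 0<N E 0≤E p (p ℕ.+ p) (lower j) (power g u p) refl))
          (*-monoˡ (0≤^ (p ℕ.+ p) 0≤E) (≤+∣∣ (inner u (power g u (p ℕ.+ p))))))
        where
        p = 2 ℕ.^ j
        double : p ℕ.+ p ≡ 2 ℕ.^ suc j
        double = cong (p ℕ.+_) (sym (ℕₚ.+-identityʳ p))

    window : ℕ → ℕ → ℕ → ℤ
    window ℓ q x = sum (suc ℓ) (λ i → g (q ℕ.* i ℕ.+ x))

    windowNorm : ℕ → ℕ → ℤ
    windowNorm ℓ q = sum N (λ x → + ∣ window ℓ q x ∣)

    0≤windowNorm : ∀ ℓ q → 0ℤ ≤ windowNorm ℓ q
    0≤windowNorm ℓ q = sum-nonneg N (λ _ → ℤ.+≤+ ℕ.z≤n)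

    module _ (pg : Periodic g) (pu : Periodic u) where

      window-periodic : ∀ ℓ q → Periodic (window ℓ q)
      window-periodic ℓ q x = sum-cong (suc ℓ) (λ i → shift (q ℕ.* i) pg x)

      -- Averaging commutes past a Hankel operator up to a shift and a reversal of the progression.
      box-hankel : ∀ ℓ q k v → Periodic v → ∀ x →
        boxSum (suc ℓ) (suc k) (λ s → hankel g v (q ℕ.* s ℕ.+ x))
          ≡ sum N (λ y → window ℓ q (q ℕ.* (k ℕ.* ℓ) ℕ.+ x ℕ.+ y) * boxSum (suc ℓ) k (λ s → v (q ℕ.* s ℕ.+ y)))
      box-hankel ℓ q k v pv x = begin
        sum (suc ℓ) (λ i → boxSum (suc ℓ) k (λ s → hankel g v (q ℕ.* (i ℕ.+ s) ℕ.+ x)))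
          ≡⟨ boxSum-sum (suc ℓ) k (suc ℓ) (λ i s → hankel g v (q ℕ.* (i ℕ.+ s) ℕ.+ x)) ⟨
        boxSum (suc ℓ) k (λ s → sum (suc ℓ) (λ i → hankel g v (q ℕ.* (i ℕ.+ s) ℕ.+ x)))
          ≡⟨ boxSum-cong< ℓ k realign ⟩
        boxSum (suc ℓ) k (λ s → sum N (λ y → ŵ y * v (q ℕ.* (k ℕ.* ℓ ∸ s) ℕ.+ y)))
          ≡⟨ boxSum-sum (suc ℓ) k N (λ y s → ŵ y * v (q ℕ.* (k ℕ.* ℓ ∸ s) ℕ.+ y)) ⟩
        sum N (λ y → boxSum (suc ℓ) k (λ s → ŵ y * v (q ℕ.* (k ℕ.* ℓ ∸ s) ℕ.+ y)))
          ≡⟨ sum-cong N (λ y → trans (boxSum-*ˡ (suc ℓ) k (ŵ y) _)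
               (cong (ŵ y *_) (boxSum-reverse ℓ k (λ s → v (q ℕ.* s ℕ.+ y))))) ⟩
        sum N (λ y → ŵ y * boxSum (suc ℓ) k (λ s → v (q ℕ.* s ℕ.+ y))) ∎
        where
        open ≡-Reasoning
        ŵ : ℕ → ℤ
        ŵ y = window ℓ q (q ℕ.* (k ℕ.* ℓ) ℕ.+ x ℕ.+ y)
        index : ∀ q i s x y → q ℕ.* (i ℕ.+ s) ℕ.+ x ℕ.+ y ≡ q ℕ.* i ℕ.+ (q ℕ.* s ℕ.+ x ℕ.+ y)
        index = ℕ-Solver.solve-∀
        merge : ∀ q s t x y → q ℕ.* s ℕ.+ x ℕ.+ (q ℕ.* t ℕ.+ y) ≡ q ℕ.* (s ℕ.+ t) ℕ.+ x ℕ.+ y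
        merge = ℕ-Solver.solve-∀
        realign : ∀ s → s ℕ.≤ k ℕ.* ℓ → sum (suc ℓ) (λ i → hankel g v (q ℕ.* (i ℕ.+ s) ℕ.+ x))
          ≡ sum N (λ y → ŵ y * v (q ℕ.* (k ℕ.* ℓ ∸ s) ℕ.+ y))
        realign s s≤ = begin
          sum (suc ℓ) (λ i → sum N (λ y → g (q ℕ.* (i ℕ.+ s) ℕ.+ x ℕ.+ y) * v y))
            ≡⟨ sum-swap (suc ℓ) N _ ⟩
          sum N (λ y → sum (suc ℓ) (λ i → g (q ℕ.* (i ℕ.+ s) ℕ.+ x ℕ.+ y) * v y))
            ≡⟨ sum-cong N (λ y → trans (sum-*ʳ (suc ℓ) (v y) _)
                 (cong (_* v y) (sum-cong (suc ℓ) (λ i → cong g (index q i s x y))))) ⟩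
          sum N (λ y → window ℓ q (q ℕ.* s ℕ.+ x ℕ.+ y) * v y)
            -- Translating y by q (kℓ - s) frees the argument of the window from s, so that the sum
            -- over s falls on `v` alone.
            ≡⟨ sum-shift (q ℕ.* (k ℕ.* ℓ ∸ s)) (λ y → cong₂ _*_ (shift (q ℕ.* s ℕ.+ x) (window-periodic ℓ q) y) (pv y)) ⟨
          sum N (λ y → window ℓ q (q ℕ.* s ℕ.+ x ℕ.+ (q ℕ.* (k ℕ.* ℓ ∸ s) ℕ.+ y)) * v (q ℕ.* (k ℕ.* ℓ ∸ s) ℕ.+ y))
            ≡⟨ sum-cong N (λ y → cong (λ z → window ℓ q z * v (q ℕ.* (k ℕ.* ℓ ∸ s) ℕ.+ y))
                 (trans (merge q s (k ℕ.* ℓ ∸ s) x y)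
                        (cong (λ z → q ℕ.* z ℕ.+ x ℕ.+ y) (ℕₚ.m+[n∸m]≡n s≤)))) ⟩
          sum N (λ y → ŵ y * v (q ℕ.* (k ℕ.* ℓ ∸ s) ℕ.+ y)) ∎

      -- Each factor G absorbs one interval average: `box-hankel` turns it into a window, whose ℓ¹
      -- norm over a period does not depend on x, and hands the other averages to the remaining
      -- power. At the end ∣u∣ ≤ 1 is used.
      box-power-bound : ∀ ℓ q k x → + ∣ boxSum (suc ℓ) k (λ s → power g u k (q ℕ.* s ℕ.+ x)) ∣ ≤ windowNorm ℓ q ^ k
      box-power-bound ℓ q zero x = ∣u∣≤1 (q ℕ.* 0 ℕ.+ x)
      box-power-bound ℓ q (suc k) x = begin
        + ∣ boxSum (suc ℓ) (suc k) (λ s → hankel g v (q ℕ.* s ℕ.+ x)) ∣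
          ≡⟨ cong (λ i → + ∣ i ∣) (box-hankel ℓ q k v (power-periodic pg pu k) x) ⟩
        + ∣ sum N (λ y → ŵ y * b y) ∣
          ≤⟨ sum-abs N _ ⟩
        sum N (λ y → + ∣ ŵ y * b y ∣)
          ≡⟨ sum-cong N (λ y → trans (cong +_ (ℤₚ.abs-* (ŵ y) (b y))) (ℤₚ.pos-* ∣ ŵ y ∣ ∣ b y ∣)) ⟩
        sum N (λ y → + ∣ ŵ y ∣ * + ∣ b y ∣)
          ≤⟨ sum-mono N (λ y → *-monoˡ {k = + ∣ ŵ y ∣} (ℤ.+≤+ ℕ.z≤n) (box-power-bound ℓ q k y)) ⟩
        sum N (λ y → + ∣ ŵ y ∣ * Y ^ k)
          ≡⟨ sum-*ʳ N (Y ^ k) _ ⟩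
        sum N (λ y → + ∣ ŵ y ∣) * Y ^ k
          ≡⟨ cong (_* Y ^ k) (sum-shift (q ℕ.* (k ℕ.* ℓ) ℕ.+ x) (λ y → cong (λ i → + ∣ i ∣) (window-periodic ℓ q y))) ⟩
        Y * Y ^ k ∎
        where
        open ℤₚ.≤-Reasoning
        Y = windowNorm ℓ q
        v = power g u k
        ŵ : ℕ → ℤ
        ŵ y = window ℓ q (q ℕ.* (k ℕ.* ℓ) ℕ.+ x ℕ.+ y)
        b : ℕ → ℤ
        b y = boxSum (suc ℓ) k (λ s → v (q ℕ.* s ℕ.+ y))

-- Small progression averages against a large Hankel form.

module SpectralGap (N : ℕ) (0<N : 0 ℕ.< N) where
  open import Data.Integer using (∣_∣; _+_; _*_; _-_; _≤_; _<_; _^_)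
  open Cyclic N
  open BoxSums
  open Hankel N

  cancelˡ : ∀ k {i j} → 0ℤ < k → k * i ≤ k * j → i ≤ j
  cancelˡ k {i} {j} 0<k = ℤₚ.*-cancelˡ-≤-pos i j k {{ℤ.positive 0<k}}

  0<* : ∀ {i j} → 0ℤ < i → 0ℤ < j → 0ℤ < i * j
  0<* {+ suc m} {+ suc n} _ _ = ℤ.+<+ (ℕ.s≤s ℕ.z≤n)
  0<* {+ zero} (ℤ.+<+ ())
  0<* {+ suc m} {+ zero} _ (ℤ.+<+ ())

  0<^ : ∀ {i} n → 0ℤ < i → 0ℤ < i ^ n
  0<^ zero _ = ℤ.+<+ (ℕ.s≤s ℕ.z≤n)
  0<^ (suc n) 0<i = 0<* 0<i (0<^ n 0<i)

  module _ {g u : ℕ → ℤ} (∣u∣≤1 : ∀ x → + ∣ u x ∣ ≤ 1ℤ) (pg : Periodic g) (pu : Periodic u)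
    (E : ℤ) (0≤E : 0ℤ ≤ E) (ℓ j : ℕ) where

    private
      p h Q : ℕ
      p = 2 ℕ.^ j
      h = suc (p ℕ.* ℓ)
      -- A sum of p elements of [0, ℓ] takes at most h values; with Q = 2h the terms a = b amount to
      -- at most half of the terms m = m′.
      Q = h ℕ.+ h
      n L l W A e M S : ℤ
      n = + N
      L = + suc ℓ
      l = L ^ p
      w : ℕ → ℤ
      w = power g u p
      c : ℕ → ℤ
      c = multiplicity (suc ℓ) p
      W = inner w w
      A = E ^ (p ℕ.+ p)
      -- `e` and `M` come from raising `small` to the power 2p; the extra n in `M` accounts for the
      -- sum over x in `smoothed`.
      e = (+ 2 * E) ^ p * (+ 2 * E) ^ p
      M = n * ((L * (n * n)) ^ p * (L * (n * n)) ^ p)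
      S = sum h (λ m → c m * c m)

    module _ (correlated : (+ N) ^ 3 ≤ E * + ∣ inner u (hankel g u) ∣)
      (small : ∀ q → 0 ℕ.< q → q ℕ.< Q → + 2 * E * windowNorm {g} {u} ∣u∣≤1 ℓ q ≤ L * (n * n)) where

      open Positivity (power-periodic pg pu p) h Q c (0≤multiplicity (suc ℓ) p)

      private
        0≤2E : 0ℤ ≤ + 2 * E
        0≤2E = 0≤*0≤ {+ 2} (ℤ.+≤+ ℕ.z≤n) 0≤E
        0≤e : 0ℤ ≤ e
        0≤e = 0≤square ((+ 2 * E) ^ p)
        0<n : 0ℤ < n
        0<n = ℤ.+<+ 0<N
        0<L : 0ℤ < L
        0<L = ℤ.+<+ (ℕ.s≤s ℕ.z≤n)
        0<l : 0ℤ < l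
        0<l = 0<^ p 0<L
        0≤M : 0ℤ ≤ M
        0≤M = 0≤*0≤ {n} (ℤₚ.<⇒≤ 0<n) (0≤square ((L * (n * n)) ^ p))

        smoothed-bound : ∀ q → 0 ℕ.< q → q ℕ.< Q → e * smoothed q ≤ M
        smoothed-bound q 0<q q<Q = begin
          e * smoothed q
            ≤⟨ *-monoˡ 0≤e (sum-bound< N (Y ^ p * Y ^ p) (λ x _ → term x)) ⟩
          e * (n * (Y ^ p * Y ^ p))
            ≡⟨ regroup ((+ 2 * E) ^ p) n (Y ^ p) ⟩
          n * ((+ 2 * E) ^ p * Y ^ p * ((+ 2 * E) ^ p * Y ^ p))
            ≡⟨ cong (λ t → n * (t * t)) (sym (^-distribʳ-* (+ 2 * E) Y p)) ⟩
          n * ((+ 2 * E * Y) ^ p * (+ 2 * E * Y) ^ p)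
            ≤⟨ *-monoˡ {k = n} (ℤₚ.<⇒≤ 0<n) (*-mono-≤ (0≤^ p 0≤2EY) le (0≤^ p 0≤2EY) le) ⟩
          M ∎
          where
          open ℤₚ.≤-Reasoning
          Y = windowNorm {g} {u} ∣u∣≤1 ℓ q
          0≤2EY : 0ℤ ≤ + 2 * E * Y
          0≤2EY = 0≤*0≤ 0≤2E (0≤windowNorm {g} {u} ∣u∣≤1 ℓ q)
          le : (+ 2 * E * Y) ^ p ≤ (L * (n * n)) ^ p
          le = ^-mono-≤ p 0≤2EY (small q 0<q q<Q)
          regroup : ∀ a n y → a * a * (n * (y * y)) ≡ n * (a * y * (a * y))
          regroup = ℤ-Solver.solve-∀
          term : ∀ x → sum h (λ m → c m * w (q ℕ.* m ℕ.+ x)) * sum h (λ m → c m * w (q ℕ.* m ℕ.+ x)) ≤ Y ^ p * Y ^ p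
          term x = subst (λ t → t * t ≤ Y ^ p * Y ^ p) (sym (boxSum-multiplicity ℓ p (λ m → w (q ℕ.* m ℕ.+ x))))
            (subst (_≤ Y ^ p * Y ^ p) (+∣∣-square b) (*-mono-≤ (ℤ.+≤+ ℕ.z≤n) ∣b∣≤ (ℤ.+≤+ ℕ.z≤n) ∣b∣≤))
            where
            b = boxSum (suc ℓ) p (λ m → w (q ℕ.* m ℕ.+ x))
            ∣b∣≤ : + ∣ b ∣ ≤ Y ^ p
            ∣b∣≤ = box-power-bound {g} {u} ∣u∣≤1 pg pu ℓ q p x

        -- The h weights `c` have sum Lᵖ, so Cauchy-Schwarz bounds the share of m = m′ from below.
        l²≤hS : l * l ≤ + h * S
        l²≤hS = subst (λ t → t * t ≤ + h * S) (sum-multiplicity ℓ p) (cauchy-schwarz h c)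

        N^ : n ^ suc (p ℕ.+ p ℕ.+ (p ℕ.+ p)) ≡ n * (n ^ p * n ^ p * (n ^ p * n ^ p))
        N^ = cong (n *_) (trans (ℤₚ.^-distribˡ-+-* n (p ℕ.+ p) (p ℕ.+ p))
          (cong₂ _*_ (ℤₚ.^-distribˡ-+-* n p p) (ℤₚ.^-distribˡ-+-* n p p)))

        V : ℤ
        V = n * (n ^ p * n ^ p * (n ^ p * n ^ p))

        0<V : 0ℤ < V
        0<V = 0<* 0<n (0<* (0<* n^p n^p) (0<* n^p n^p))
          where n^p = 0<^ p 0<n

        M≡ : M ≡ l * l * V
        M≡ = trans (cong (λ t → n * (t * t)) (trans (^-distribʳ-* L (n * n) p) (cong (l *_) (^-distribʳ-* n n p))))
          (regroup n l (n ^ p))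
          where
          regroup : ∀ n l v → n * (l * (v * v) * (l * (v * v))) ≡ l * l * (n * (v * v * (v * v)))
          regroup = ℤ-Solver.solve-∀

        e≡ : e ≡ (+ 2) ^ (p ℕ.+ p) * A
        e≡ = trans (cong (λ t → t * t) (^-distribʳ-* (+ 2) E p)) (trans (regroup ((+ 2) ^ p) (E ^ p))
          (cong₂ _*_ (sym (ℤₚ.^-distribˡ-+-* (+ 2) p p)) (sym (ℤₚ.^-distribˡ-+-* E p p))))
          where
          regroup : ∀ a b → a * b * (a * b) ≡ a * a * (b * b)
          regroup = ℤ-Solver.solve-∀

        combined : e * (l * l * (+ Q * (+ Q * W))) ≤ + h * (+ Q * (e * (l * l * W) + + Q * M))
        combined = begin
          e * (l * l * (+ Q * (+ Q * W)))
            ≤⟨ *-monoˡ 0≤e (*-mono-≤ (0≤square l) l²≤hS (0≤*0≤ {+ Q} (ℤ.+≤+ ℕ.z≤n) (0≤*0≤ {+ Q} (ℤ.+≤+ ℕ.z≤n) 0≤energy)) ℤₚ.≤-refl) ⟩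
          e * (+ h * S * (+ Q * (+ Q * W)))
            ≡⟨ regroup e (+ h) S (+ Q * (+ Q * W)) ⟩
          + h * (e * (S * (+ Q * (+ Q * W))))
            ≤⟨ *-monoˡ {k = + h} (ℤ.+≤+ ℕ.z≤n) (positivity e M 0≤e 0≤M smoothed-bound) ⟩
          + h * (+ Q * (e * (sum h c * sum h c * W) + + Q * M))
            ≡⟨ cong (λ t → + h * (+ Q * (e * (t * t * W) + + Q * M))) (sum-multiplicity ℓ p) ⟩
          + h * (+ Q * (e * (l * l * W) + + Q * M)) ∎
          where
          open ℤₚ.≤-Reasoning
          regroup : ∀ e h s t → e * (h * s * t) ≡ h * (e * (s * t))
          regroup = ℤ-Solver.solve-∀

        -- As Q = 2h, the energy term on the right of `combined` is exactly half of the left side;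
        -- it is moved over and Q h cancelled.
        halved : l * l * (e * W) ≤ l * l * (+ Q * V)
        halved = cancelˡ (+ Q * + h) (0<* {+ Q} (ℤ.+<+ (ℕ.s≤s ℕ.z≤n)) (ℤ.+<+ (ℕ.s≤s ℕ.z≤n)))
          (ℤₚ.0≤i-j⇒j≤i (subst (0ℤ ≤_) (eq e l (+ h) W V) (ℤₚ.i≤j⇒0≤j-i combined′)))
          where
          combined′ : e * (l * l * ((+ h + + h) * ((+ h + + h) * W)))
            ≤ + h * ((+ h + + h) * (e * (l * l * W) + (+ h + + h) * (l * l * V)))
          combined′ = subst (λ m → e * (l * l * (+ Q * (+ Q * W))) ≤ + h * (+ Q * (e * (l * l * W) + + Q * m))) M≡ combined
          eq : ∀ e l h w v →
            h * ((h + h) * (e * (l * l * w) + (h + h) * (l * l * v))) - e * (l * l * ((h + h) * ((h + h) * w)))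
              ≡ (h + h) * h * (l * l * ((h + h) * v)) - (h + h) * h * (l * l * (e * w))
          eq = ℤ-Solver.solve-∀

      -- `energy-growth` says V ≤ A W and `halved` says 2^(2p) A W ≤ Q V. The factor 2 in `small` is
      -- thus amplified to 2^(2p), while the loss Q is only linear in p; a large p will contradict
      -- this inequality.
      spectral-gap : (+ 2) ^ (p ℕ.+ p) ≤ + (h ℕ.+ h)
      spectral-gap = cancelˡ V 0<V (begin
        V * (+ 2) ^ (p ℕ.+ p)               ≡⟨ ℤₚ.*-comm V ((+ 2) ^ (p ℕ.+ p)) ⟩
        (+ 2) ^ (p ℕ.+ p) * V               ≡⟨ cong ((+ 2) ^ (p ℕ.+ p) *_) (sym N^) ⟩
        (+ 2) ^ (p ℕ.+ p) * n ^ suc (p ℕ.+ p ℕ.+ (p ℕ.+ p))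
          ≤⟨ *-monoˡ (0≤^ {+ 2} (p ℕ.+ p) (ℤ.+≤+ ℕ.z≤n)) (energy-growth {g} {u} ∣u∣≤1 0<N E 0≤E correlated j) ⟩
        (+ 2) ^ (p ℕ.+ p) * (A * W)         ≡⟨ sym (ℤₚ.*-assoc ((+ 2) ^ (p ℕ.+ p)) A W) ⟩
        (+ 2) ^ (p ℕ.+ p) * A * W           ≡⟨ cong (_* W) (sym e≡) ⟩
        e * W                             ≤⟨ cancelˡ (l * l) (0<* 0<l 0<l) halved ⟩
        + Q * V                           ≡⟨ ℤₚ.*-comm (+ Q) V ⟩
        V * + Q ∎)
        where open ℤₚ.≤-Reasoning

-- Counting, and the balanced function of a set.

count : ℕ → (ℕ → Bool) → ℕ
count zero A = 0
count (suc n) A = count n A ℕ.+ (if A n then 1 else 0)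

count-≤ : ∀ n A → count n A ℕ.≤ n
count-≤ zero A = ℕ.z≤n
count-≤ (suc n) A with A n
... | true = subst (ℕ._≤ suc n) (ℕₚ.+-comm 1 (count n A)) (ℕ.s≤s (count-≤ n A))
... | false = subst (ℕ._≤ suc n) (sym (ℕₚ.+-identityʳ (count n A))) (ℕₚ.m≤n⇒m≤1+n (count-≤ n A))

sum-indicator : ∀ n A → sum n (λ i → indicator (A i)) ≡ + count n A
sum-indicator zero A = refl
sum-indicator (suc n) A with A n
... | true = trans (cong (ℤ._+ 1ℤ) (sum-indicator n A)) (sym (ℤₚ.pos-+ (count n A) 1))
... | false = trans (cong (ℤ._+ 0ℤ) (sum-indicator n A)) (sym (ℤₚ.pos-+ (count n A) 0))

module Balanced (k : ℕ) (A : ℕ → Bool) where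
  open import Data.Integer using (∣_∣; _+_; _*_; _-_; -_; _≤_)

  private
    N : ℕ
    N = suc k
    n α : ℤ
    n = + N
    α = + count N A

  open Cyclic N
  open Hankel N

  balanced : ℕ → ℤ
  balanced x = n * indicator (A x) - α

  balanced-abs : ∀ x → + ∣ balanced x ∣ ≤ n
  balanced-abs x with A x
  ... | true = subst (_≤ n)
    (sym (trans (cong (λ t → + ∣ t - α ∣) (ℤₚ.*-identityʳ n)) (ℤₚ.0≤i⇒+∣i∣≡i (ℤₚ.i≤j⇒0≤j-i (ℤ.+≤+ (count-≤ N A))))))
    (ℤₚ.i≤j⇒i-k≤j α ℤₚ.≤-refl)
  ... | false = subst (_≤ n)
    (sym (cong +_ (trans (cong ∣_∣ (trans (cong (_- α) (ℤₚ.*-zeroʳ n)) (ℤₚ.+-identityˡ (- α)))) (ℤₚ.∣-i∣≡∣i∣ α))))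
    (ℤ.+≤+ (count-≤ N A))

  sum-balanced : ∀ m B → sum m (λ i → n * indicator (B i) - α) ≡ n * + count m B - + m * α
  sum-balanced m B = trans (sum-+ m _ _) (cong₂ _+_
    (trans (sum-*ˡ m n _) (cong (n *_) (sum-indicator m B)))
    (trans (sum-const m (- α)) (sym (ℤₚ.neg-distribʳ-* (+ m) α))))

  wrapped : ℕ → ℤ
  wrapped x = balanced (x % N)

  wrapped-periodic : Periodic wrapped
  wrapped-periodic x = cong balanced ([m+n]%n≡m%n x N)

  wrapped-< : ∀ {x} → x ℕ.< N → wrapped x ≡ balanced x
  wrapped-< x<N = cong balanced (m<n⇒m%n≡m x<N)

  sum-wrapped : sum N wrapped ≡ 0ℤ
  sum-wrapped = trans (sum-cong< N (λ x → wrapped-<)) (trans (sum-balanced N A) (ℤₚ.+-inverseʳ (n * α)))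

  progression : ℕ → ℕ → ℕ → ℤ
  progression ℓ q x = sum (suc ℓ) (λ i → wrapped (q ℕ.* i ℕ.+ x))

  progression-periodic : ∀ ℓ q → Periodic (progression ℓ q)
  progression-periodic ℓ q x = sum-cong (suc ℓ) (λ i → shift (q ℕ.* i) wrapped-periodic x)

  sum-progression : ∀ ℓ q → sum N (progression ℓ q) ≡ 0ℤ
  sum-progression ℓ q = trans (sum-swap N (suc ℓ) _)
    (trans (sum-cong (suc ℓ) (λ i → trans (sum-shift (q ℕ.* i) wrapped-periodic) sum-wrapped)) (sum-0 (suc ℓ)))

  progression-abs : ∀ ℓ q x → + ∣ progression ℓ q x ∣ ≤ + suc ℓ * n
  progression-abs ℓ q x = ℤₚ.≤-trans (sum-abs (suc ℓ) _) (sum-bound< (suc ℓ) n (λ i _ → balanced-abs ((q ℕ.* i ℕ.+ x) % N)))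

  -- ∣b∣ + b is twice the positive part of b, so a bound from above on b is enough.
  abs+self : ∀ {e c} b → 0ℤ ≤ e → 0ℤ ≤ c → e * b ≤ c → e * (+ ∣ b ∣ + b) ≤ c + c
  abs+self {e} {c} (+ m) 0≤e 0≤c le = subst (_≤ c + c) (sym (ℤₚ.*-distribˡ-+ e (+ m) (+ m))) (ℤₚ.+-mono-≤ le le)
  abs+self {e} {c} b@(ℤ.-[1+ m ]) 0≤e 0≤c le = subst (_≤ c + c)
    (sym (trans (cong (e *_) (ℤₚ.+-inverseˡ b)) (ℤₚ.*-zeroʳ e))) (ℤₚ.+-mono-≤ 0≤c 0≤c)

  -- As Σ_x progression ℓ q x = 0, the absolute values sum to twice the positive parts.
  no-bias : ∀ E ℓ q → 0ℤ ≤ E → q ℕ.* ℓ ℕ.≤ N → + 8 * E * + (q ℕ.* ℓ) ≤ n →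
    (∀ x → q ℕ.* ℓ ℕ.+ x ℕ.< N → + 8 * E * sum (suc ℓ) (λ i → balanced (q ℕ.* i ℕ.+ x)) ≤ + suc ℓ * n) →
    + 2 * E * sum N (λ x → + ∣ progression ℓ q x ∣) ≤ + suc ℓ * (n * n)
  no-bias E ℓ q 0≤E qℓ≤N size windows = ℤₚ.*-cancelˡ-≤-pos _ _ (+ 4) (begin
    + 4 * (+ 2 * E * sum N (λ x → + ∣ b x ∣))
      ≡⟨ regroup₁ E (sum N (λ x → + ∣ b x ∣)) ⟩
    + 8 * E * (sum N (λ x → + ∣ b x ∣) + 0ℤ)
      ≡⟨ cong (λ t → + 8 * E * (sum N (λ x → + ∣ b x ∣) + t)) (sum-progression ℓ q) ⟨
    + 8 * E * (sum N (λ x → + ∣ b x ∣) + sum N b)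
      ≡⟨ cong (+ 8 * E *_) (sum-+ N _ _) ⟨
    + 8 * E * sum N (λ x → + ∣ b x ∣ + b x)
      ≡⟨ sum-*ˡ N (+ 8 * E) _ ⟨
    sum N (λ x → + 8 * E * (+ ∣ b x ∣ + b x))
      -- Starting points below N - qℓ give progressions that do not wrap, and `windows` applies. The
      -- other qℓ are bounded trivially and paid for by `size`. Each part is at most 2LN², in total
      -- 4LN², which turns 8E into 2E.
      ≡⟨ cong (λ t → sum t (λ x → + 8 * E * (+ ∣ b x ∣ + b x))) (ℕₚ.m∸n+n≡m qℓ≤N) ⟨
    sum (m ℕ.+ q ℕ.* ℓ) (λ x → + 8 * E * (+ ∣ b x ∣ + b x))
      ≡⟨ sum-split m (q ℕ.* ℓ) _ ⟩
    sum m (λ x → + 8 * E * (+ ∣ b x ∣ + b x)) + sum (q ℕ.* ℓ) (λ x → + 8 * E * (+ ∣ b (m ℕ.+ x) ∣ + b (m ℕ.+ x)))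
      ≤⟨ ℤₚ.+-mono-≤ (sum-bound< m (Ln + Ln) inner-bound)
           (sum-bound< (q ℕ.* ℓ) (+ 8 * E * (Ln + Ln)) (λ x _ → *-monoˡ 0≤8E (ℤₚ.+-mono-≤ (progression-abs ℓ q (m ℕ.+ x))
             (ℤₚ.≤-trans (≤+∣∣ (b (m ℕ.+ x))) (progression-abs ℓ q (m ℕ.+ x)))))) ⟩
    + m * (Ln + Ln) + + (q ℕ.* ℓ) * (+ 8 * E * (Ln + Ln))
      ≡⟨ regroup₂ (+ m) (Ln + Ln) (+ (q ℕ.* ℓ)) (+ 8 * E) ⟩
    (Ln + Ln) * (+ m + + 8 * E * + (q ℕ.* ℓ))
      ≤⟨ *-monoˡ 0≤2Ln (ℤₚ.+-mono-≤ (ℤ.+≤+ (ℕₚ.m∸n≤m N (q ℕ.* ℓ))) size) ⟩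
    (Ln + Ln) * (n + n)
      ≡⟨ regroup₃ (+ suc ℓ) n ⟩
    + 4 * (+ suc ℓ * (n * n)) ∎)
    where
    open ℤₚ.≤-Reasoning
    b : ℕ → ℤ
    b = progression ℓ q
    m = N ∸ q ℕ.* ℓ
    Ln = + suc ℓ * n
    0≤8E : 0ℤ ≤ + 8 * E
    0≤8E = 0≤*0≤ {+ 8} (ℤ.+≤+ ℕ.z≤n) 0≤E
    0≤Ln : 0ℤ ≤ Ln
    0≤Ln = 0≤*0≤ {+ suc ℓ} {n} (ℤ.+≤+ ℕ.z≤n) (ℤ.+≤+ ℕ.z≤n)
    0≤2Ln : 0ℤ ≤ Ln + Ln
    0≤2Ln = ℤₚ.+-mono-≤ 0≤Ln 0≤Ln
    regroup₁ : ∀ e y → + 4 * (+ 2 * e * y) ≡ + 8 * e * (y + 0ℤ)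
    regroup₁ = ℤ-Solver.solve-∀
    regroup₂ : ∀ m t s e → m * t + s * (e * t) ≡ t * (m + e * s)
    regroup₂ = ℤ-Solver.solve-∀
    regroup₃ : ∀ l n → (l * n + l * n) * (n + n) ≡ + 4 * (l * (n * n))
    regroup₃ = ℤ-Solver.solve-∀
    inner-bound : ∀ x → x ℕ.< m → + 8 * E * (+ ∣ b x ∣ + b x) ≤ Ln + Ln
    inner-bound x x<m = abs+self (b x) 0≤8E 0≤Ln
      (subst (λ t → + 8 * E * t ≤ Ln) (sym (sum-cong< (suc ℓ) (λ i i≤ℓ → wrapped-< (ℕₚ.≤-<-trans
        (ℕₚ.+-monoˡ-≤ x (ℕₚ.*-monoʳ-≤ q (ℕₚ.≤-pred i≤ℓ))) last<N)))) (windows x last<N))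
      where
      last<N : q ℕ.* ℓ ℕ.+ x ℕ.< N
      last<N = subst (q ℕ.* ℓ ℕ.+ x ℕ.<_) (ℕₚ.m+[n∸m]≡n qℓ≤N) (ℕₚ.+-monoʳ-< (q ℕ.* ℓ) x<m)

-- Density increment or uniformity.

module Dichotomy (k : ℕ) (A : ℕ → Bool) where
  open import Data.Integer using (∣_∣; _+_; _*_; _-_; -_; _≤_; _<_; _^_)

  private
    N : ℕ
    N = suc k
    n α : ℤ
    n = + N
    α = + count N A

  open Cyclic N
  open Hankel N
  open Balanced k A

  degree : (ℕ → Bool) → ℕ → ℕ → ℕ
  degree X a x = count N (λ y → X y ∧ A (a ℕ.+ (x ℕ.+ y)))

  edges : (ℕ → Bool) → ℕ → ℤ
  edges X a = sum N (λ x → indicator (X x) * + degree X a x)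

  -- This keeps pairs from `X` away from the wraparound in `wrapped`.
  Admissible : (ℕ → Bool) → ℕ → Set
  Admissible X a = ∀ x y → X x ≡ true → X y ≡ true → x ℕ.< N → y ℕ.< N → a ℕ.+ (x ℕ.+ y) ℕ.< N

  -- After division by E N: the number of adjacent pairs in `X` falls short of its expected value
  -- |A||X|²/N by less than N²/E.
  Uniform : ℕ → Set
  Uniform E = ∀ X a → Admissible X a →
    + E * (α * (+ count N X * + count N X)) < n ^ 3 + + E * (n * edges X a)

  -- After division by 8E(ℓ+1)N: the density on the progression exceeds |A|/N by more than 1/(8E).
  Denser : ℕ → ℕ → Set
  Denser E ℓ = ∃ λ q → ∃ λ x → 0 ℕ.< q × q ℕ.* ℓ ℕ.+ x ℕ.< N ×
    8 ℕ.* E ℕ.* (suc ℓ ℕ.* count N A) ℕ.+ suc ℓ ℕ.* N ℕ.< 8 ℕ.* E ℕ.* (N ℕ.* count (suc ℓ) (λ i → A (q ℕ.* i ℕ.+ x)))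

  denser? : ∀ E ℓ Q → Denser E ℓ ⊎ (∀ q x → 0 ℕ.< q → q ℕ.< Q → q ℕ.* ℓ ℕ.+ x ℕ.< N →
    8 ℕ.* E ℕ.* (N ℕ.* count (suc ℓ) (λ i → A (q ℕ.* i ℕ.+ x))) ℕ.≤ 8 ℕ.* E ℕ.* (suc ℓ ℕ.* count N A) ℕ.+ suc ℓ ℕ.* N)
  denser? E ℓ Q with ℕₚ.anyUpTo? (λ q → ℕₚ.anyUpTo? (λ x → (0 ℕₚ.<? q) ×-dec (q ℕ.* ℓ ℕ.+ x ℕₚ.<? N) ×-dec
      (8 ℕ.* E ℕ.* (suc ℓ ℕ.* count N A) ℕ.+ suc ℓ ℕ.* N ℕₚ.<? 8 ℕ.* E ℕ.* (N ℕ.* count (suc ℓ) (λ i → A (q ℕ.* i ℕ.+ x))))) N) Q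
  ... | yes (q , _ , x , _ , found) = inj₁ (q , x , found)
  ... | no none = inj₂ (λ q x 0<q q<Q last<N → ℕₚ.≮⇒≥ (λ lt →
    none (q , q<Q , x , ℕₚ.≤-<-trans (ℕₚ.m≤n+m x (q ℕ.* ℓ)) last<N , 0<q , last<N , lt)))

  module _ (X : ℕ → Bool) (a : ℕ) (adm : Admissible X a) where

    private
      g u : ℕ → ℤ
      g x = wrapped (a ℕ.+ x)
      u x = indicator (X (x % N))
      ξ : ℤ
      ξ = + count N X

    ∣u∣≤1 : ∀ x → + ∣ u x ∣ ≤ 1ℤ
    ∣u∣≤1 x with X (x % N)
    ... | true = ℤₚ.≤-refl
    ... | false = ℤ.+≤+ ℕ.z≤n

    g-periodic : Periodic g
    g-periodic = shift a wrapped-periodic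

    u-periodic : Periodic u
    u-periodic x = cong (λ y → indicator (X y)) ([m+n]%n≡m%n x N)

    u-< : ∀ {x} → x ℕ.< N → u x ≡ indicator (X x)
    u-< x<N = cong (λ y → indicator (X y)) (m<n⇒m%n≡m x<N)

    -- For x, y in `X` the index a + x + y does not wrap, so each entry is N·1_A - |A|, and the form
    -- is N times the deviation of `edges` from its expected value.
    bilinear : inner u (hankel g u) ≡ n * edges X a - α * (ξ * ξ)
    bilinear = begin
      sum N (λ x → u x * sum N (λ y → g (x ℕ.+ y) * u y))
        ≡⟨ sum-cong< N row ⟩
      sum N (λ x → n * (indicator (X x) * + degree X a x) + indicator (X x) * - (α * ξ))
        ≡⟨ trans (sum-+ N _ _) (cong₂ _+_ (sum-*ˡ N n _) (trans (sum-*ʳ N (- (α * ξ)) _) (cong (_* - (α * ξ)) (sum-indicator N X)))) ⟩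
      n * edges X a + ξ * - (α * ξ)
        ≡⟨ cong (λ t → n * edges X a + t) (regroup ξ α) ⟩
      n * edges X a - α * (ξ * ξ) ∎
      where
      open ≡-Reasoning
      regroup : ∀ x a → x * - (a * x) ≡ - (a * (x * x))
      regroup = ℤ-Solver.solve-∀
      entry : ∀ x y → X x ≡ true → x ℕ.< N → y ℕ.< N →
        g (x ℕ.+ y) * u y ≡ n * indicator (X y ∧ A (a ℕ.+ (x ℕ.+ y))) + - α * indicator (X y)
      entry x y Xx x<N y<N rewrite u-< y<N with X y in Xy
      ... | true = trans (ℤₚ.*-identityʳ _) (trans (wrapped-< (adm x y Xx Xy x<N y<N))
        (cong (λ t → n * indicator (A (a ℕ.+ (x ℕ.+ y))) + t) (sym (ℤₚ.*-identityʳ (- α)))))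
      ... | false = trans (ℤₚ.*-zeroʳ (g (x ℕ.+ y))) (sym (cong₂ _+_ (ℤₚ.*-zeroʳ n) (ℤₚ.*-zeroʳ (- α))))
      row : ∀ x → x ℕ.< N → u x * sum N (λ y → g (x ℕ.+ y) * u y)
        ≡ n * (indicator (X x) * + degree X a x) + indicator (X x) * - (α * ξ)
      row x x<N rewrite u-< x<N with X x in Xx
      ... | false = sym (cong₂ _+_ (ℤₚ.*-zeroʳ n) (ℤₚ.*-zeroˡ (- (α * ξ))))
      ... | true = begin
        1ℤ * sum N (λ y → g (x ℕ.+ y) * u y)
          ≡⟨ ℤₚ.*-identityˡ _ ⟩
        sum N (λ y → g (x ℕ.+ y) * u y)
          ≡⟨ sum-cong< N (λ y → entry x y Xx x<N) ⟩
        sum N (λ y → n * indicator (X y ∧ A (a ℕ.+ (x ℕ.+ y))) + - α * indicator (X y))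
          ≡⟨ trans (sum-+ N _ _) (cong₂ _+_ (trans (sum-*ˡ N n _) (cong (n *_) (sum-indicator N _)))
               (trans (sum-*ˡ N (- α) _) (cong (- α *_) (sum-indicator N X)))) ⟩
        n * + degree X a x + - α * ξ
          ≡⟨ final n (+ degree X a x) α ξ ⟩
        n * (1ℤ * + degree X a x) + 1ℤ * - (α * ξ) ∎
        where
        final : ∀ n d a x → n * d + - a * x ≡ n * (1ℤ * d) + 1ℤ * - (a * x)
        final = ℤ-Solver.solve-∀

    windowNorm-progression : ∀ ℓ q → windowNorm {g} {u} ∣u∣≤1 ℓ q ≡ sum N (λ x → + ∣ progression ℓ q x ∣)
    windowNorm-progression ℓ q = trans
      (sum-cong N (λ x → cong (λ t → + ∣ t ∣) (sum-cong (suc ℓ) (λ i → cong wrapped (move a (q ℕ.* i) x)))))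
      (sum-shift a (λ x → cong (λ t → + ∣ t ∣) (progression-periodic ℓ q x)))
      where
      move : ∀ a b x → a ℕ.+ (b ℕ.+ x) ≡ b ℕ.+ (a ℕ.+ x)
      move = ℕ-Solver.solve-∀

  -- If the finite search `denser?` fails, `no-bias` supplies `small` for every q; a set violating
  -- `Uniform` would supply `correlated`, and then `spectral-gap` contradicts the hypothesis on
  -- 2^(2p).
  dichotomy : ∀ E ℓ j → let p = 2 ℕ.^ j ; h = suc (p ℕ.* ℓ) in
    8 ℕ.* E ℕ.* ((h ℕ.+ h) ℕ.* ℓ) ℕ.≤ N → (h ℕ.+ h) ℕ.* ℓ ℕ.≤ N → h ℕ.+ h ℕ.< 2 ℕ.^ (p ℕ.+ p) →
    Denser E ℓ ⊎ Uniform E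
  dichotomy E ℓ j size fits gap with denser? E ℓ (suc (2 ℕ.^ j ℕ.* ℓ) ℕ.+ suc (2 ℕ.^ j ℕ.* ℓ))
  ... | inj₁ found = inj₁ found
  ... | inj₂ none = inj₂ uniform
    where
    open ℤₚ.≤-Reasoning
    p h Q : ℕ
    p = 2 ℕ.^ j
    h = suc (p ℕ.* ℓ)
    Q = h ℕ.+ h
    pos-8E : + 8 * + E ≡ + (8 ℕ.* E)
    pos-8E = sym (ℤₚ.pos-* 8 E)
    windows : ∀ q → 0 ℕ.< q → q ℕ.< Q → ∀ x → q ℕ.* ℓ ℕ.+ x ℕ.< N →
      + 8 * + E * sum (suc ℓ) (λ i → balanced (q ℕ.* i ℕ.+ x)) ≤ + suc ℓ * n
    windows q 0<q q<Q x last<N = begin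
      + 8 * + E * sum (suc ℓ) (λ i → balanced (q ℕ.* i ℕ.+ x))
        ≡⟨ cong₂ _*_ pos-8E (sum-balanced (suc ℓ) (λ i → A (q ℕ.* i ℕ.+ x))) ⟩
      + (8 ℕ.* E) * (n * + c - + suc ℓ * α)
        ≡⟨ regroup (+ (8 ℕ.* E)) (n * + c) (+ suc ℓ * α) ⟩
      + (8 ℕ.* E) * (n * + c) - + (8 ℕ.* E) * (+ suc ℓ * α)
        ≡⟨ cong₂ _-_ (trans (cong (+ (8 ℕ.* E) *_) (sym (ℤₚ.pos-* N c))) (sym (ℤₚ.pos-* (8 ℕ.* E) (N ℕ.* c))))
                     (trans (cong (+ (8 ℕ.* E) *_) (sym (ℤₚ.pos-* (suc ℓ) (count N A)))) (sym (ℤₚ.pos-* (8 ℕ.* E) (suc ℓ ℕ.* count N A)))) ⟩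
      + (8 ℕ.* E ℕ.* (N ℕ.* c)) - + D
        ≤⟨ ℤₚ.+-monoˡ-≤ (- + D) (ℤ.+≤+ (none q x 0<q q<Q last<N)) ⟩
      + (D ℕ.+ suc ℓ ℕ.* N) - + D
        ≡⟨ cong (_- + D) (ℤₚ.pos-+ D (suc ℓ ℕ.* N)) ⟩
      + D + + (suc ℓ ℕ.* N) - + D
        ≡⟨ trans (cancel (+ D) (+ (suc ℓ ℕ.* N))) (ℤₚ.pos-* (suc ℓ) N) ⟩
      + suc ℓ * n ∎
      where
      c = count (suc ℓ) (λ i → A (q ℕ.* i ℕ.+ x))
      D = 8 ℕ.* E ℕ.* (suc ℓ ℕ.* count N A)
      regroup : ∀ e a b → e * (a - b) ≡ e * a - e * b
      regroup = ℤ-Solver.solve-∀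
      cancel : ∀ d t → d + t - d ≡ t
      cancel = ℤ-Solver.solve-∀
    uniform : Uniform E
    uniform X a adm with + E * (α * (+ count N X * + count N X)) ℤₚ.<? n ^ 3 + + E * (n * edges X a)
    ... | yes lt = lt
    ... | no ≮ = ⊥-elim (ℕₚ.<⇒≱ gap (ℤ.drop‿+≤+ (subst (_≤ + Q) (sym (pos-^ 2 (p ℕ.+ p)))
      (SpectralGap.spectral-gap N (ℕ.s≤s ℕ.z≤n) (∣u∣≤1 X a adm) (g-periodic X a adm) (u-periodic X a adm)
        (+ E) (ℤ.+≤+ ℕ.z≤n) ℓ j correlated small))))
      where
      ξ = + count N X
      B = n * edges X a - α * (ξ * ξ)
      correlated : n ^ 3 ≤ + E * + ∣ inner (λ x → indicator (X (x % N))) (hankel (λ x → wrapped (a ℕ.+ x)) (λ x → indicator (X (x % N)))) ∣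
      correlated = begin
        n ^ 3                 ≤⟨ ℤₚ.0≤i-j⇒j≤i (subst (0ℤ ≤_) (regroup (n ^ 3) (+ E) n (edges X a) α (ξ * ξ)) (ℤₚ.i≤j⇒0≤j-i (ℤₚ.≮⇒≥ ≮))) ⟩
        + E * - B             ≤⟨ *-monoˡ {k = + E} (ℤ.+≤+ ℕ.z≤n) (≤+∣∣ (- B)) ⟩
        + E * + ∣ - B ∣       ≡⟨ cong (λ t → + E * + t) (trans (ℤₚ.∣-i∣≡∣i∣ B) (cong ∣_∣ (sym (bilinear X a adm)))) ⟩
        _ ∎
        where
        regroup : ∀ t e n d a x → e * (a * x) - (t + e * (n * d)) ≡ e * - (n * d - a * x) - t
        regroup = ℤ-Solver.solve-∀
      small : ∀ q → 0 ℕ.< q → q ℕ.< Q →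
        + 2 * + E * windowNorm {λ x → wrapped (a ℕ.+ x)} {λ x → indicator (X (x % N))} (∣u∣≤1 X a adm) ℓ q ≤ + suc ℓ * (n * n)
      small q 0<q q<Q = subst (λ t → + 2 * + E * t ≤ + suc ℓ * (n * n)) (sym (windowNorm-progression X a adm ℓ q))
        (no-bias (+ E) ℓ q (ℤ.+≤+ ℕ.z≤n)
          (ℕₚ.≤-trans (ℕₚ.*-monoˡ-≤ ℓ (ℕₚ.<⇒≤ q<Q)) fits)
          (subst (_≤ n) (trans (ℤₚ.pos-* (8 ℕ.* E) (q ℕ.* ℓ)) (cong (_* + (q ℕ.* ℓ)) (sym pos-8E)))
            (ℤ.+≤+ (ℕₚ.≤-trans (ℕₚ.*-monoʳ-≤ (8 ℕ.* E) (ℕₚ.*-monoˡ-≤ ℓ (ℕₚ.<⇒≤ q<Q))) size)))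
          (windows q 0<q q<Q))

-- Positions are 0, ..., N - 1 and membership is a Boolean function, so that restriction to a
-- progression is mere substitution.
Configuration : ℕ → ℕ → (ℕ → Bool) → Set
Configuration d N A = Σ ℕ λ a → Σ (Fin d → ℕ) λ n → Injective _≡_ _≡_ n ×
  (∀ i j → i Fin.≤ j → n i ℕ.+ n j ℕ.+ a ℕ.< N × A (n i ℕ.+ n j ℕ.+ a) ≡ true)

-- Elementary counting and pigeonhole.

module Counting where
  open import Data.Nat using (_+_; _≤_; _<_; z≤n; s≤s)

  bit : Bool → ℕ
  bit b = if b then 1 else 0

  count-subadditive : ∀ n {B C D : ℕ → Bool} → (∀ y → bit (B y) ≤ bit (C y) + bit (D y)) →
    count n B ≤ count n C + count n D
  count-subadditive zero le = z≤n
  count-subadditive (suc n) {B} {C} {D} le = ℕₚ.≤-trans (ℕₚ.+-mono-≤ (count-subadditive n {B} {C} {D} le) (le n))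
    (ℕₚ.≤-reflexive (interchange (count n C) (count n D) (bit (C n)) (bit (D n))))
    where
    interchange : ∀ a b c d → a + b + (c + d) ≡ a + c + (b + d)
    interchange = ℕ-Solver.solve-∀

  count-singleton : ∀ {n x} → x < n → count n (x ℕ.≡ᵇ_) ≡ 1
  count-singleton {n} {x} x<n = ℤₚ.+-injective (trans (sym (sum-indicator n (x ℕ.≡ᵇ_)))
    (trans (sum-cong n (λ m → sym (ℤₚ.*-identityʳ (indicator (x ℕ.≡ᵇ m))))) (sum-δ n x (λ _ → 1ℤ) x<n)))

  count-remove : ∀ {n x} (B : ℕ → Bool) → x < n → count n B ≤ count n (λ y → B y ∧ not (x ℕ.≡ᵇ y)) + 1
  count-remove {n} {x} B x<n = subst (λ t → count n B ≤ count n (λ y → B y ∧ not (x ℕ.≡ᵇ y)) + t) (count-singleton x<n)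
    (count-subadditive n {B} {λ y → B y ∧ not (x ℕ.≡ᵇ y)} {x ℕ.≡ᵇ_} (λ y → split (B y) (x ℕ.≡ᵇ y)))
    where
    split : ∀ b c → bit b ≤ bit (b ∧ not c) + bit c
    split false c = z≤n
    split true true = s≤s z≤n
    split true false = s≤s z≤n

  count-cong< : ∀ n {B C} → (∀ y → y < n → B y ≡ C y) → count n B ≡ count n C
  count-cong< zero eq = refl
  count-cong< (suc n) eq = cong₂ _+_ (count-cong< n (λ y y<n → eq y (ℕₚ.m<n⇒m<1+n y<n))) (cong bit (eq n ℕₚ.≤-refl))

  count-monoˡ : ∀ m n B → count n B ≤ count (m + n) B
  count-monoˡ zero n B = ℕₚ.≤-refl
  count-monoˡ (suc m) n B = ℕₚ.≤-trans (count-monoˡ m n B) (ℕₚ.m≤m+n (count (m + n) B) (bit (B (m + n))))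

  count-parity : ∀ m B → count (m + m) B ≡ count m (λ y → B (y + y)) + count m (λ y → B (suc (y + y)))
  count-parity zero B = refl
  count-parity (suc m) B = trans (cong (λ t → count t B) (ℕₚ.+-suc (suc m) m))
    (trans (cong (λ c → c + bit (B (m + m)) + bit (B (suc (m + m)))) (count-parity m B))
      (interchange (count m (λ y → B (y + y))) (count m (λ y → B (suc (y + y)))) (bit (B (m + m))) (bit (B (suc (m + m))))))
    where
    interchange : ∀ a b c d → a + b + c + d ≡ a + c + (b + d)
    interchange = ℕ-Solver.solve-∀

sum-exists : ∀ n {f g : ℕ → ℤ} → sum n f ℤ.< sum n g → ∃ λ i → i ℕ.< n × f i ℤ.< g i
sum-exists zero (ℤ.+<+ ())
sum-exists (suc n) {f} {g} lt with f n ℤₚ.<? g n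
... | yes fn<gn = n , ℕₚ.≤-refl , fn<gn
... | no fn≮gn with sum n f ℤₚ.<? sum n g
...   | yes lt′ = let (i , i<n , fi<gi) = sum-exists n lt′ in i , ℕₚ.m<n⇒m<1+n i<n , fi<gi
...   | no ≮ = ⊥-elim (ℤₚ.<⇒≱ lt (ℤₚ.+-mono-≤ (ℤₚ.≮⇒≥ ≮) (ℤₚ.≮⇒≥ fn≮gn)))

∧-true : ∀ {a b} → a ∧ b ≡ true → a ≡ true × b ≡ true
∧-true {true} {true} _ = refl , refl

-- A vertex of large degree.

module PopularVertex (k : ℕ) (A : ℕ → Bool) (r K : ℕ) where
  open import Data.Integer using (_+_; _*_; _≤_; _<_; _^_)
  open Dichotomy k A

  private
    N E : ℕ
    N = suc k
    E = 4 ℕ.* r ℕ.* (K ℕ.* K)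

  module _ (uniform : Uniform E) (N≤rα : N ℕ.≤ r ℕ.* count N A) where

    -- The choice E = 4rK² makes E|A||X|² at least 4N³, so the error N³ in `Uniform` leaves more
    -- than half of the expected edges. Some vertex of `X` then has degree at least |A||X|/(2N),
    -- hence at least |X|/(2r).
    popular : ∀ X a → Admissible X a → N ℕ.≤ count N X ℕ.* K →
      ∃ λ x → x ℕ.< N × X x ≡ true × count N X ℕ.≤ 2 ℕ.* r ℕ.* degree X a x
    popular X a adm N≤ξK = let (x , x<N , lt) = sum-exists N many in x , x<N , extract x lt
      where
      n α ξ e κ ρ a′ : ℤ
      n = + N
      α = + count N A
      ξ = + count N X
      e = edges X a
      κ = + K
      ρ = + r
      a′ = + E * (α * (ξ * ξ))
      0≤ : ∀ {m} → 0ℤ ≤ + m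
      0≤ = ℤ.+≤+ ℕ.z≤n
      E≡ : + E ≡ + 4 * ρ * (κ * κ)
      E≡ = trans (ℤₚ.pos-* (4 ℕ.* r) (K ℕ.* K)) (cong₂ _*_ (ℤₚ.pos-* 4 r) (ℤₚ.pos-* K K))
      n≤ρα : n ≤ ρ * α
      n≤ρα = subst (n ≤_) (ℤₚ.pos-* r (count N A)) (ℤ.+≤+ N≤rα)
      n≤ξκ : n ≤ ξ * κ
      n≤ξκ = subst (n ≤_) (ℤₚ.pos-* (count N X) K) (ℤ.+≤+ N≤ξK)
      2n³≤a′ : n ^ 3 + n ^ 3 ≤ a′
      2n³≤a′ = begin
        n ^ 3 + n ^ 3                               ≤⟨ ℤₚ.i≤j+i (n ^ 3 + n ^ 3) (n ^ 3 + n ^ 3) {{ℤ.nonNegative (ℤₚ.+-mono-≤ (0≤^ {n} 3 0≤) (0≤^ {n} 3 0≤))}} ⟩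
        n ^ 3 + n ^ 3 + (n ^ 3 + n ^ 3)             ≡⟨ regroup₁ n ⟩
        + 4 * (n * (n * n))                         ≤⟨ *-monoˡ {k = + 4} 0≤ (*-mono-≤ {n} 0≤ n≤ρα (0≤*0≤ {n} {n} 0≤ 0≤) (*-mono-≤ {n} {k = n} 0≤ n≤ξκ 0≤ n≤ξκ)) ⟩
        + 4 * (ρ * α * (ξ * κ * (ξ * κ)))           ≡⟨ regroup₂ ρ α ξ κ ⟩
        + 4 * ρ * (κ * κ) * (α * (ξ * ξ))           ≡⟨ cong (_* (α * (ξ * ξ))) (sym E≡) ⟩
        a′                                          ∎
        where
        open ℤₚ.≤-Reasoning
        regroup₁ : ∀ n → n * (n * (n * 1ℤ)) + n * (n * (n * 1ℤ)) + (n * (n * (n * 1ℤ)) + n * (n * (n * 1ℤ))) ≡ + 4 * (n * (n * n))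
        regroup₁ = ℤ-Solver.solve-∀
        regroup₂ : ∀ r a x c → + 4 * (r * a * (x * c * (x * c))) ≡ + 4 * r * (c * c) * (a * (x * x))
        regroup₂ = ℤ-Solver.solve-∀
      dense : α * (ξ * ξ) < n * e + n * e
      dense with α * (ξ * ξ) ℤₚ.<? n * e + n * e
      ... | yes lt = lt
      ... | no ≮ = ⊥-elim (ℤₚ.<-irrefl refl (begin-strict
        a′ + a′                                            <⟨ ℤₚ.+-mono-< (uniform X a adm) (uniform X a adm) ⟩
        n ^ 3 + + E * (n * e) + (n ^ 3 + + E * (n * e))    ≡⟨ regroup (n ^ 3) (+ E) (n * e) ⟩
        n ^ 3 + n ^ 3 + + E * (n * e + n * e)              ≤⟨ ℤₚ.+-mono-≤ 2n³≤a′ (*-monoˡ {k = + E} 0≤ (ℤₚ.≮⇒≥ ≮)) ⟩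
        a′ + a′                                            ∎))
        where
        open ℤₚ.≤-Reasoning
        regroup : ∀ t e m → t + e * m + (t + e * m) ≡ t + t + e * (m + m)
        regroup = ℤ-Solver.solve-∀
      many : sum N (λ x → indicator (X x) * (α * ξ)) < sum N (λ x → (n + n) * (indicator (X x) * + degree X a x))
      many = subst₂ _<_
        (trans (regroup α ξ) (trans (cong (_* (α * ξ)) (sym (sum-indicator N X))) (sym (sum-*ʳ N (α * ξ) _))))
        (trans (sym (ℤₚ.*-distribʳ-+ e n n)) (sym (sum-*ˡ N (n + n) _))) dense
        where
        regroup : ∀ a x → a * (x * x) ≡ x * (a * x)
        regroup = ℤ-Solver.solve-∀
      extract : ∀ x → indicator (X x) * (α * ξ) < (n + n) * (indicator (X x) * + degree X a x) →
        X x ≡ true × count N X ℕ.≤ 2 ℕ.* r ℕ.* degree X a x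
      extract x lt with X x
      ... | false = ⊥-elim (ℤₚ.<-irrefl (trans (ℤₚ.*-zeroˡ (α * ξ)) (sym (ℤₚ.*-zeroʳ (n + n)))) lt)
      ... | true = refl , ℤ.drop‿+≤+ (ℤₚ.*-cancelˡ-≤-pos ξ (+ (2 ℕ.* r ℕ.* D)) n (begin
        n * ξ                            ≤⟨ *-mono-≤ {n} {k = ξ} 0≤ n≤ρα 0≤ ℤₚ.≤-refl ⟩
        ρ * α * ξ                        ≡⟨ regroup₁ ρ α ξ ⟩
        ρ * (1ℤ * (α * ξ))               ≤⟨ *-monoˡ {k = ρ} 0≤ (ℤₚ.<⇒≤ lt) ⟩
        ρ * ((n + n) * (1ℤ * + D))       ≡⟨ regroup₂ ρ n (+ D) ⟩
        n * (+ 2 * ρ * + D)              ≡⟨ cong (n *_) (sym (trans (ℤₚ.pos-* (2 ℕ.* r) D) (cong (_* + D) (ℤₚ.pos-* 2 r)))) ⟩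
        n * + (2 ℕ.* r ℕ.* D)            ∎))
        where
        open ℤₚ.≤-Reasoning
        D = degree X a x
        regroup₁ : ∀ r a x → r * a * x ≡ r * (1ℤ * (a * x))
        regroup₁ = ℤ-Solver.solve-∀
        regroup₂ : ∀ r n d → r * ((n + n) * (1ℤ * d)) ≡ n * (+ 2 * r * d)
        regroup₂ = ℤ-Solver.solve-∀

0<4* : ∀ {r} → 0 ℕ.< r → 0 ℕ.< 4 ℕ.* r
0<4* {r} 0<r = ℕₚ.*-mono-< {0} {4} {0} {r} (ℕ.s≤s ℕ.z≤n) 0<r

-- Greedy construction of a clique.

module Clique (k : ℕ) (A : ℕ → Bool) (r d : ℕ) (0<r : 0 ℕ.< r) where
  open import Data.Nat using (_+_; _*_; _≤_; _<_; _^_; s≤s)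
  open Counting
  open Dichotomy k A

  private
    N K E : ℕ
    N = suc k
    -- The first candidate set has at least N/(4r) elements and each new vertex costs a factor 4r,
    -- so every candidate set still to be extended has at least N/K.
    K = (4 * r) ^ d
    E = 4 * r * (K * K)

  module _ (uniform : Uniform E) (N≤rα : N ≤ r * count N A) (large : (4 * r) ^ suc d ≤ N) where

    Pairs : (ℕ → Bool) → ℕ → Set
    Pairs X a = ∀ x → X x ≡ true → a + (x + x) < N × A (a + (x + x)) ≡ true

    -- a + x + y is the average of a + 2x and a + 2y, both below N.
    pairs⇒admissible : ∀ {X a} → Pairs X a → Admissible X a
    pairs⇒admissible {X} {a} pairs x y Xx Xy _ _ = ℕₚ.*-cancelˡ-< 2 (a + (x + y)) N (subst₂ _<_ (average a x y) (double N)
      (ℕₚ.+-mono-< (proj₁ (pairs x Xx)) (proj₁ (pairs y Xy))))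
      where
      average : ∀ a x y → a + (x + x) + (a + (y + y)) ≡ 2 * (a + (x + y))
      average = ℕ-Solver.solve-∀
      double : ∀ n → n + n ≡ 2 * n
      double = ℕ-Solver.solve-∀

    -- As a + 2x lies in `A`, every vertex is adjacent to itself; x is struck out to keep the
    -- vertices distinct.
    neighbours : (ℕ → Bool) → ℕ → ℕ → ℕ → Bool
    neighbours X a x y = (X y ∧ A (a + (x + y))) ∧ not (x ℕ.≡ᵇ y)

    neighbours⇒ : ∀ X a x {y} → neighbours X a x y ≡ true → X y ≡ true × A (a + (x + y)) ≡ true × x ≢ y
    neighbours⇒ X a x {y} eq with ∧-true {X y ∧ A (a + (x + y))} eq
    ... | eq₁ , eq₂ with ∧-true {X y} eq₁
    ...   | Xy , Axy = Xy , Axy , λ { refl → contra (trans (sym eq₂) (cong not (≡ᵇ-refl x))) }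
      where
      contra : true ≡ false → ⊥
      contra ()

    -- The degree costs 2r and the removal of x another 2: `large` gives ξ ≥ 4r, so doubling ξ ≤
    -- 2r(ξ′ + 1) yields 2ξ ≤ 4rξ′ + 4r ≤ 4rξ′ + ξ.
    size-step : ∀ e ξ ξ′ D → suc e ≤ d → N ≤ ξ * (4 * r) ^ suc e → ξ ≤ 2 * r * D → D ≤ ξ′ + 1 →
      N ≤ ξ′ * (4 * r) ^ suc (suc e)
    size-step e ξ ξ′ D 1+e≤d size ξ≤2rD D≤ = begin
      N                     ≤⟨ size ⟩
      ξ * K′                ≤⟨ ℕₚ.*-monoˡ-≤ K′ ξ≤4rξ′ ⟩
      4 * r * ξ′ * K′       ≡⟨ regroup (4 * r) ξ′ K′ ⟩
      ξ′ * (4 * r * K′)     ∎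
      where
      open ℕₚ.≤-Reasoning
      instance
        4r≢0 : ℕ.NonZero (4 * r)
        4r≢0 = ℕ.>-nonZero (0<4* 0<r)
      K′ : ℕ
      K′ = (4 * r) ^ suc e
      regroup : ∀ r x c → r * x * c ≡ x * (r * c)
      regroup = ℕ-Solver.solve-∀
      4r≤ξ : 4 * r ≤ ξ
      4r≤ξ = ℕₚ.*-cancelʳ-≤ (4 * r) ξ K′ {{ℕₚ.m^n≢0 (4 * r) (suc e)}}
        (ℕₚ.≤-trans (ℕₚ.*-monoʳ-≤ (4 * r) (ℕₚ.^-monoʳ-≤ (4 * r) 1+e≤d)) (ℕₚ.≤-trans large size))
      double : ∀ r x → 2 * r * (x + 1) + 2 * r * (x + 1) ≡ 4 * r * x + 4 * r
      double = ℕ-Solver.solve-∀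
      ξ≤2r : ξ ≤ 2 * r * (ξ′ + 1)
      ξ≤2r = ℕₚ.≤-trans ξ≤2rD (ℕₚ.*-monoʳ-≤ (2 * r) D≤)
      ξ≤4rξ′ : ξ ≤ 4 * r * ξ′
      ξ≤4rξ′ = ℕₚ.+-cancelʳ-≤ ξ ξ (4 * r * ξ′) (begin
        ξ + ξ                                  ≤⟨ ℕₚ.+-mono-≤ ξ≤2r ξ≤2r ⟩
        2 * r * (ξ′ + 1) + 2 * r * (ξ′ + 1)    ≡⟨ double r ξ′ ⟩
        4 * r * ξ′ + 4 * r                     ≤⟨ ℕₚ.+-monoʳ-≤ (4 * r * ξ′) 4r≤ξ ⟩
        4 * r * ξ′ + ξ                         ∎)

    extend : ∀ e X a → suc e ≤ d → N ≤ count N X * (4 * r) ^ suc e → Pairs X a →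
      ∃ λ x → X x ≡ true × N ≤ count N (neighbours X a x) * (4 * r) ^ suc (suc e)
    extend e X a 1+e≤d size pairs
      with PopularVertex.popular k A r K uniform N≤rα X a (pairs⇒admissible {X} {a} pairs)
        (ℕₚ.≤-trans size (ℕₚ.*-monoʳ-≤ (count N X) (ℕₚ.^-monoʳ-≤ (4 * r) {{ℕ.>-nonZero (0<4* 0<r)}} 1+e≤d)))
    ... | x , x<N , Xx , ξ≤2rD = x , Xx , size-step e (count N X) (count N (neighbours X a x)) (degree X a x)
      1+e≤d size ξ≤2rD (count-remove (λ y → X y ∧ A (a + (x + y))) x<N)

    CliqueIn : (ℕ → Bool) → ℕ → ℕ → Set
    CliqueIn X a m = Σ (Fin m → ℕ) λ n → Injective _≡_ _≡_ n × (∀ i → X (n i) ≡ true) ×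
      (∀ i j → i Fin.≤ j → A (a + (n i + n j)) ≡ true)

    cons : ∀ {X a m x} → Pairs X a → X x ≡ true → CliqueIn (neighbours X a x) a m → CliqueIn X a (suc m)
    cons {X} {a} {m} {x} pairs Xx (n′ , injective′ , inX′ , inA′) = n , (λ {i} {j} → injective i j) , inX , inA
      where
      n : Fin (suc m) → ℕ
      n Fin.zero = x
      n (Fin.suc i) = n′ i
      injective : ∀ i j → n i ≡ n j → i ≡ j
      injective Fin.zero Fin.zero _ = refl
      injective Fin.zero (Fin.suc j) eq = ⊥-elim (proj₂ (proj₂ (neighbours⇒ X a x (inX′ j))) eq)
      injective (Fin.suc i) Fin.zero eq = ⊥-elim (proj₂ (proj₂ (neighbours⇒ X a x (inX′ i))) (sym eq))
      injective (Fin.suc i) (Fin.suc j) eq = cong Fin.suc (injective′ eq)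
      inX : ∀ i → X (n i) ≡ true
      inX Fin.zero = Xx
      inX (Fin.suc i) = proj₁ (neighbours⇒ X a x (inX′ i))
      inA : ∀ i j → i Fin.≤ j → A (a + (n i + n j)) ≡ true
      inA Fin.zero Fin.zero _ = proj₂ (pairs x Xx)
      inA Fin.zero (Fin.suc j) _ = proj₁ (proj₂ (neighbours⇒ X a x (inX′ j)))
      inA (Fin.suc i) (Fin.suc j) (s≤s i≤j) = inA′ i j i≤j

    -- `e` vertices have been chosen and `m` remain to be found; e + m = d keeps `suc e ≤ d` at each
    -- extension, as the choice of `K` requires.
    clique : ∀ m e X a → e + m ≡ d → N ≤ count N X * (4 * r) ^ suc e → Pairs X a → CliqueIn X a m
    clique zero e X a _ _ _ = (λ ()) , (λ { {()} }) , (λ ()) , (λ ())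
    clique (suc m) e X a e+m≡d size pairs =
      let (x , Xx , size′) = extend e X a (subst (suc e ≤_) (trans (sym (ℕₚ.+-suc e m)) e+m≡d) (ℕₚ.m≤m+n (suc e) m)) size pairs
      in cons {X} {a} pairs Xx
        (clique m (suc e) (neighbours X a x) a (trans (sym (ℕₚ.+-suc e m)) e+m≡d) size′
          (λ y y∈ → pairs y (proj₁ (neighbours⇒ X a x y∈))))

    restricted : ℕ → Bool
    restricted y = (y ℕ.<ᵇ N) ∧ A y

    configuration-in-class : ∀ a → count N A ≤ count N (λ y → restricted (a + (y + y))) + count N (λ y → restricted (a + (y + y))) →
      Configuration d N A
    configuration-in-class a half = a , n , proj₁ (proj₂ found) , member
      where
      X : ℕ → Bool
      X y = restricted (a + (y + y))
      pairs : Pairs X a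
      pairs y Xy = let (lt , Ay) = ∧-true Xy in ℕₚ.<ᵇ⇒< (a + (y + y)) N (subst T (sym lt) _) , Ay
      size : N ≤ count N X * (4 * r) ^ 1
      size = begin
        N                               ≤⟨ N≤rα ⟩
        r * count N A                   ≤⟨ ℕₚ.*-monoʳ-≤ r half ⟩
        r * (count N X + count N X)     ≤⟨ ℕₚ.m≤m+n _ (r * (count N X + count N X)) ⟩
        r * (count N X + count N X) + r * (count N X + count N X) ≡⟨ regroup r (count N X) ⟩
        count N X * (4 * r * 1)         ∎
        where
        open ℕₚ.≤-Reasoning
        regroup : ∀ r c → r * (c + c) + r * (c + c) ≡ c * (4 * r * 1)
        regroup = ℕ-Solver.solve-∀
      found = clique d 0 X a refl size pairs
      n = proj₁ found
      member : ∀ i j → i Fin.≤ j → n i + n j + a < N × A (n i + n j + a) ≡ true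
      member i j i≤j = subst (λ t → t < N × A t ≡ true) (ℕₚ.+-comm a (n i + n j))
        (adm , proj₂ (proj₂ (proj₂ found)) i j i≤j)
        where
        inX = proj₁ (proj₂ (proj₂ found))
        below : ∀ i → n i < N
        below i = ℕₚ.≤-<-trans (ℕₚ.≤-trans (ℕₚ.m≤m+n (n i) (n i)) (ℕₚ.m≤n+m (n i + n i) a)) (proj₁ (pairs (n i) (inX i)))
        adm = pairs⇒admissible {X} {a} pairs (n i) (n j) (inX i) (inX j) (below i) (below j)

    -- Elements are split by parity, so one of a = 0 and a = 1 retains at least half of them. The
    -- cutoff in `restricted` discards the indices beyond N - 1 that y + y reaches.
    count-restricted : count N A ≤ count N (λ y → restricted (y + y)) + count N (λ y → restricted (suc (y + y)))
    count-restricted = ℕₚ.≤-trans (ℕₚ.≤-reflexive (count-cong< N (λ y y<N → cong (_∧ A y) (sym (<ᵇ-true y<N)))))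
      (ℕₚ.≤-trans (count-monoˡ N N restricted) (ℕₚ.≤-reflexive (count-parity N restricted)))
      where
      <ᵇ-true : ∀ {a b} → a < b → (a ℕ.<ᵇ b) ≡ true
      <ᵇ-true {a} {b} a<b with a ℕ.<ᵇ b | ℕₚ.<⇒<ᵇ a<b
      ... | true | _ = refl

    configuration : Configuration d N A
    configuration with ℕₚ.≤-total c₀ c₁
      where
      c₀ = count N (λ y → restricted (y + y))
      c₁ = count N (λ y → restricted (suc (y + y)))
    ... | inj₁ c₀≤c₁ = configuration-in-class 1 (ℕₚ.≤-trans count-restricted (ℕₚ.+-monoˡ-≤ (count N (λ y → restricted (suc (y + y)))) c₀≤c₁))
    ... | inj₂ c₁≤c₀ = configuration-in-class 0 (ℕₚ.≤-trans count-restricted (ℕₚ.+-monoʳ-≤ (count N (λ y → restricted (y + y))) c₁≤c₀))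

-- The iteration of density increments and its scales.

module Iteration (r d : ℕ) (0<r : 0 ℕ.< r) where
  open import Data.Nat using (_+_; _*_; _≤_; _<_; _^_; z≤n; s≤s)

  private
    K E : ℕ
    K = (4 * r) ^ d
    E = 4 * r * (K * K)

  -- The identity q(s + t + a) + x = qs + qt + (qa + x) shows that affine maps carry configurations
  -- to configurations; q > 0 preserves injectivity.
  configuration-affine : ∀ {ℓ N A} q x → 0 < q → q * ℓ + x < N →
    Configuration d (suc ℓ) (λ i → A (q * i + x)) → Configuration d N A
  configuration-affine {ℓ} {N} {A} q x 0<q last<N (a , n , injective , member) =
    q * a + x , (λ i → q * n i) , (λ eq → injective (ℕₚ.*-cancelˡ-≡ _ _ q {{ℕ.>-nonZero 0<q}} eq)) , member′
    where
    collect : ∀ q x a s t → q * (s + t + a) + x ≡ q * s + q * t + (q * a + x)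
    collect = ℕ-Solver.solve-∀
    member′ : ∀ i j → i Fin.≤ j → q * n i + q * n j + (q * a + x) < N × A (q * n i + q * n j + (q * a + x)) ≡ true
    member′ i j i≤j = subst (λ t → t < N × A t ≡ true) (collect q x a (n i) (n j))
      ( ℕₚ.≤-<-trans (ℕₚ.+-monoˡ-≤ x (ℕₚ.*-monoʳ-≤ q (ℕₚ.≤-pred (proj₁ (member i j i≤j))))) last<N
      , proj₂ (member i j i≤j))

  n<2^n : ∀ n → n < 2 ^ n
  n<2^n zero = s≤s z≤n
  n<2^n (suc n) = ℕₚ.≤-trans (ℕₚ.+-mono-≤ (ℕₚ.m^n>0 2 n) (n<2^n n)) (ℕₚ.≤-reflexive (cong (λ t → 2 ^ n + t) (sym (ℕₚ.+-identityʳ (2 ^ n)))))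

  0<K : 0 < K
  0<K = ℕₚ.m^n>0 (4 * r) {{ℕ.>-nonZero (0<4* 0<r)}} d

  0<E : 0 < E
  0<E = ℕₚ.*-mono-< {0} {4 * r} (0<4* 0<r) (ℕₚ.*-mono-< {0} {K} 0<K 0<K)

  4rK≤E : (4 * r) ^ suc d ≤ E
  4rK≤E = ℕₚ.*-monoʳ-≤ (4 * r) (ℕₚ.m≤m*n K K {{ℕ.>-nonZero 0<K}})

  module Scales (i ℓ : ℕ) (L≡ : suc ℓ ≡ 2 ^ (2 ^ (2 + (E + i)))) where
    j p h L : ℕ
    j = 2 + (E + i)
    p = 2 ^ j
    h = suc (p * ℓ)
    L = suc ℓ

    p≤L : p ≤ L
    p≤L = subst (p ≤_) (sym L≡) (ℕₚ.<⇒≤ (n<2^n p))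

    E≤L : E ≤ L
    E≤L = ℕₚ.≤-trans (ℕₚ.≤-trans (ℕₚ.m≤m+n E i) (ℕₚ.m≤n+m (E + i) 2)) (ℕₚ.≤-trans (ℕₚ.<⇒≤ (n<2^n j)) p≤L)

    h≤pL : h ≤ p * L
    h≤pL = ℕₚ.≤-trans (ℕₚ.+-monoˡ-≤ (p * ℓ) (ℕₚ.m^n>0 2 j)) (ℕₚ.≤-reflexive (sym (ℕₚ.*-suc p ℓ)))

    -- L = 2ᵖ makes the right side L², while h ≤ pL; so 2p < L suffices, and this follows from p =
    -- 2ʲ and j + 1 < p.
    gap : h + h < 2 ^ (p + p)
    gap = begin-strict
      h + h            ≤⟨ ℕₚ.+-mono-≤ h≤pL h≤pL ⟩
      p * L + p * L    ≡⟨ ℕₚ.*-distribʳ-+ L p p ⟨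
      (p + p) * L      <⟨ ℕₚ.*-monoˡ-< L 2p<L ⟩
      L * L            ≡⟨ cong₂ _*_ L≡ L≡ ⟩
      2 ^ p * 2 ^ p    ≡⟨ ℕₚ.^-distribˡ-+-* 2 p p ⟨
      2 ^ (p + p)      ∎
      where
      open ℕₚ.≤-Reasoning
      1+j<p : suc j < p
      1+j<p = begin-strict
        suc j                           <⟨ ℕₚ.≤-refl ⟩
        4 + (E + i)                     ≤⟨ ℕₚ.+-monoʳ-≤ 4 (ℕₚ.m≤m+n (E + i) (3 * (E + i))) ⟩
        4 + 4 * (E + i)                 ≡⟨ ℕₚ.*-suc 4 (E + i) ⟨
        4 * suc (E + i)                 ≤⟨ ℕₚ.*-monoʳ-≤ 4 (n<2^n (E + i)) ⟩
        4 * 2 ^ (E + i)                 ≡⟨ ℕₚ.*-assoc 2 2 (2 ^ (E + i)) ⟩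
        p                               ∎
      2p<L : p + p < L
      2p<L = subst₂ _<_ (cong (λ t → p + t) (ℕₚ.+-identityʳ p)) (sym L≡) (ℕₚ.^-monoʳ-< 2 (s≤s (s≤s z≤n)) 1+j<p)

    L⁴ : ℕ
    L⁴ = L * L * (L * L)

    8E2hℓ≤ : 8 * E * ((h + h) * ℓ) ≤ 16 * L⁴
    8E2hℓ≤ = begin
      8 * E * ((h + h) * ℓ)            ≤⟨ ℕₚ.*-mono-≤ (ℕₚ.*-monoʳ-≤ 8 E≤L) (ℕₚ.*-mono-≤ (ℕₚ.+-mono-≤ h≤L² h≤L²) (ℕₚ.n≤1+n ℓ)) ⟩
      8 * L * ((L * L + L * L) * L)    ≡⟨ collect L ⟩
      16 * L⁴                          ∎
      where
      open ℕₚ.≤-Reasoning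
      h≤L² : h ≤ L * L
      h≤L² = ℕₚ.≤-trans h≤pL (ℕₚ.*-monoˡ-≤ L p≤L)
      collect : ∀ l → 8 * l * ((l * l + l * l) * l) ≡ 16 * (l * l * (l * l))
      collect = ℕ-Solver.solve-∀

    16≤L⁴ : 16 ≤ L⁴
    16≤L⁴ = ℕₚ.*-mono-≤ {4} {L * L} (ℕₚ.*-mono-≤ 2≤L 2≤L) (ℕₚ.*-mono-≤ 2≤L 2≤L)
      where
      2≤L : 2 ≤ L
      2≤L = subst (2 ≤_) (sym L≡) (ℕₚ.^-monoʳ-≤ 2 (ℕₚ.m^n>0 2 j))

    module _ {N : ℕ} (large : 2 ^ (2 ^ (3 + j)) ≤ N) where

      -- The threshold equals (2ᵖ)⁸. Since 8E(2h)ℓ ≤ 16L⁴, an eighth power leaves room for `size`,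
      -- and it adds only 3 to the inner exponent.
      L⁸≤N : L⁴ * L⁴ ≤ N
      L⁸≤N = subst (_≤ N) eq large
        where
        eighth : ∀ p → 2 * (2 * (2 * p)) ≡ p + p + (p + p) + (p + p + (p + p))
        eighth = ℕ-Solver.solve-∀
        open ≡-Reasoning
        eq : 2 ^ (2 ^ (3 + j)) ≡ L⁴ * L⁴
        eq = begin
          2 ^ (2 * (2 * (2 * p)))
            ≡⟨ cong (2 ^_) (eighth p) ⟩
          2 ^ (p + p + (p + p) + (p + p + (p + p)))
            ≡⟨ split (p + p + (p + p)) ⟩
          2 ^ (p + p + (p + p)) * 2 ^ (p + p + (p + p))
            ≡⟨ cong (λ t → t * t) (trans (split (p + p)) (cong (λ t → t * t) (split p))) ⟩
          2 ^ p * 2 ^ p * (2 ^ p * 2 ^ p) * (2 ^ p * 2 ^ p * (2 ^ p * 2 ^ p))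
            ≡⟨ cong (λ t → t * t * (t * t) * (t * t * (t * t))) (sym L≡) ⟩
          L⁴ * L⁴ ∎
          where
          split : ∀ m → 2 ^ (m + m) ≡ 2 ^ m * 2 ^ m
          split m = ℕₚ.^-distribˡ-+-* 2 m m

      size : 8 * E * ((h + h) * ℓ) ≤ N
      size = ℕₚ.≤-trans 8E2hℓ≤ (ℕₚ.≤-trans (ℕₚ.*-monoˡ-≤ L⁴ 16≤L⁴) L⁸≤N)

      fits : (h + h) * ℓ ≤ N
      fits = ℕₚ.≤-trans (ℕₚ.m≤n*m ((h + h) * ℓ) (8 * E) {{ℕ.>-nonZero (ℕₚ.*-mono-< {0} {8} (s≤s z≤n) 0<E)}}) size

      4rK≤N : (4 * r) ^ suc d ≤ N
      4rK≤N = begin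
        (4 * r) ^ suc d    ≤⟨ 4rK≤E ⟩
        E                  ≤⟨ E≤L ⟩
        L                  ≤⟨ ℕₚ.m≤m*n L L ⟩
        L * L              ≤⟨ ℕₚ.m≤m*n (L * L) (L * L) ⟩
        L⁴                 ≤⟨ ℕₚ.m≤m*n L⁴ L⁴ ⟩
        L⁴ * L⁴            ≤⟨ L⁸≤N ⟩
        N                  ∎
        where open ℕₚ.≤-Reasoning

  -- The invariant says that the density exceeds 1 - S/(8E); a gain of 1/(8E) lowers S by one.
  excess-step : ∀ L N α α′ S → 0 < N → 8 * E * (L * α) + L * N < 8 * E * (N * α′) → 8 * E * N < 8 * E * α + suc S * N →
    8 * E * L < 8 * E * α′ + S * L
  excess-step L N α α′ S 0<N gain excess = ℕₚ.*-cancelˡ-< N (8 * E * L) (8 * E * α′ + S * L) (begin-strict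
    N * (8 * E * L)                               ≡⟨ regroup₁ E L N ⟩
    L * (8 * E * N)                               ≤⟨ ℕₚ.*-monoʳ-≤ L (ℕₚ.<⇒≤ excess) ⟩
    L * (8 * E * α + suc S * N)                   ≡⟨ regroup₂ E L N α S ⟩
    8 * E * (L * α) + L * N + L * (S * N)         <⟨ ℕₚ.+-monoˡ-< (L * (S * N)) gain ⟩
    8 * E * (N * α′) + L * (S * N)                ≡⟨ regroup₃ E L N α′ S ⟩
    N * (8 * E * α′ + S * L)                      ∎)
    where
    open ℕₚ.≤-Reasoning
    regroup₁ : ∀ e l n → n * (8 * e * l) ≡ l * (8 * e * n)
    regroup₁ = ℕ-Solver.solve-∀
    regroup₂ : ∀ e l n a s → l * (8 * e * a + (n + s * n)) ≡ 8 * e * (l * a) + l * n + l * (s * n)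
    regroup₂ = ℕ-Solver.solve-∀
    regroup₃ : ∀ e l n a s → 8 * e * (n * a) + l * (s * n) ≡ n * (8 * e * a + s * l)
    regroup₃ = ℕ-Solver.solve-∀

  density-step : ∀ L N α α′ → 0 < N → 8 * E * (L * α) + L * N < 8 * E * (N * α′) → N ≤ r * α → L ≤ r * α′
  density-step L N α α′ 0<N gain N≤rα = ℕₚ.*-cancelˡ-≤ N {{ℕ.>-nonZero 0<N}} (begin
    N * L            ≡⟨ ℕₚ.*-comm N L ⟩
    L * N            ≤⟨ ℕₚ.*-monoʳ-≤ L N≤rα ⟩
    L * (r * α)      ≡⟨ regroup L r α ⟩
    r * (L * α)      ≤⟨ ℕₚ.*-monoʳ-≤ r (ℕₚ.<⇒≤ (ℕₚ.*-cancelˡ-< (8 * E) (L * α) (N * α′) (ℕₚ.≤-<-trans (ℕₚ.m≤m+n (8 * E * (L * α)) (L * N)) gain))) ⟩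
    r * (N * α′)     ≡⟨ regroup r N α′ ⟩
    N * (r * α′)     ∎)
    where
    open ℕₚ.≤-Reasoning
    regroup : ∀ l r a → l * (r * a) ≡ r * (l * a)
    regroup = ℕ-Solver.solve-∀

  -- `S` bounds the number of increments still possible: at S = 0 the density would exceed 1. An
  -- increment takes an eighth root of the length, hence the 3 * S in the inner exponent.
  iterate : ∀ S k A → 8 * E * suc k < 8 * E * count (suc k) A + S * suc k → suc k ≤ r * count (suc k) A →
    2 ^ (2 ^ (2 + (E + 3 * S))) ≤ suc k → Configuration d (suc k) A
  iterate zero k A excess _ _ = ⊥-elim (ℕₚ.<⇒≱ excess (ℕₚ.≤-trans (ℕₚ.≤-reflexive (ℕₚ.+-identityʳ _))
    (ℕₚ.*-monoʳ-≤ (8 * E) (count-≤ (suc k) A))))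
  iterate (suc S) k A excess N≤rα large = [ denser , sparse ]′
    (Dichotomy.dichotomy k A E ℓ j (size large′) (fits large′) gap)
    where
    ℓ : ℕ
    -- `suc ℓ` is exactly the threshold for `S`, so the recursive call meets its size condition with
    -- equality.
    ℓ = ℕ.pred (2 ^ (2 ^ (2 + (E + 3 * S))))
    L≡ : suc ℓ ≡ 2 ^ (2 ^ (2 + (E + 3 * S)))
    L≡ = ℕₚ.suc-pred (2 ^ (2 ^ (2 + (E + 3 * S)))) {{ℕₚ.m^n≢0 2 (2 ^ (2 + (E + 3 * S)))}}
    open Scales (3 * S) ℓ L≡ using (j; size; fits; gap; 4rK≤N)
    shift-index : ∀ e s → 2 + (e + 3 * suc s) ≡ 3 + (2 + (e + 3 * s))
    shift-index = ℕ-Solver.solve-∀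
    large′ : 2 ^ (2 ^ (3 + j)) ≤ suc k
    large′ = subst (λ t → 2 ^ (2 ^ t) ≤ suc k) (shift-index E S) large
    denser : Dichotomy.Denser k A E ℓ → Configuration d (suc k) A
    denser (q , x , 0<q , last<N , gain) = configuration-affine {ℓ} {suc k} {A} q x 0<q last<N
      (iterate S ℓ (λ i → A (q * i + x))
        (excess-step (suc ℓ) (suc k) (count (suc k) A) (count (suc ℓ) (λ i → A (q * i + x))) S (s≤s z≤n) gain excess)
        (density-step (suc ℓ) (suc k) (count (suc k) A) (count (suc ℓ) (λ i → A (q * i + x))) (s≤s z≤n) gain N≤rα)
        (ℕₚ.≤-reflexive (sym L≡)))
    sparse : Dichotomy.Uniform k A E → Configuration d (suc k) A
    sparse uniform = Clique.configuration k A r d 0<r uniform N≤rα (4rK≤N large′)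

  -- At most 8E density increments of 1/(8E) are possible, and each divides log N by 8.
  dense⇒configuration : ∀ N A → N ≤ r * count N A → 2 ^ (2 ^ (2 + 25 * E)) ≤ N → Configuration d N A
  dense⇒configuration zero A _ large = ⊥-elim (ℕₚ.<⇒≱ (ℕₚ.m^n>0 2 (2 ^ (2 + 25 * E))) large)
  dense⇒configuration (suc k) A N≤rα large = iterate (8 * E) k A
    -- At S = 8E the excess condition amounts to α > 0; the exponent is 25E = E + 3 · 8E.
    (ℕₚ.m<n+m (8 * E * suc k) (ℕₚ.*-mono-< {0} {8 * E} (ℕₚ.*-mono-< {0} {8} (s≤s z≤n) 0<E) 0<α)) N≤rα
    (subst (λ t → 2 ^ (2 ^ (2 + t)) ≤ suc k) (total E) large)
    where
    total : ∀ e → 25 * e ≡ e + 3 * (8 * e)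
    total = ℕ-Solver.solve-∀
    0<α : 0 < count (suc k) A
    0<α = ℕₚ.n≢0⇒n>0 (λ α≡0 → ℕₚ.<⇒≱ (s≤s (z≤n {k})) (subst (λ t → suc k ≤ t) (trans (cong (r *_) α≡0) (ℕₚ.*-zeroʳ r)) N≤rα))

-- Rational lower bounds for the double exponential.

module Exponential where
  open import Data.Rational using (_+_; _*_; _≤_)

  ι : ℕ → ℚ
  ι n = (+ n) ℚ./ 1

  toℚᵘ-/ : ∀ m n → ℚ.toℚᵘ ((+ m) ℚ./ suc n) ℚᵘ.≃ mkℚᵘ (+ m) n
  toℚᵘ-/ m n = ℚₚ.toℚᵘ-fromℚᵘ (mkℚᵘ (+ m) n)

  -- Unnormalised fractions compare by cross-multiplication, bypassing the gcd in `ℚ./`.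
  ι-≤-*/ : ∀ a c n D .{{_ : ℕ.NonZero D}} → a ℕ.* D ℕ.≤ c ℕ.* n → ι a ≤ ι c * ((+ n) ℚ./ D)
  ι-≤-*/ a c n (suc D) le = ℚₚ.toℚᵘ-cancel-≤ (begin
    ℚ.toℚᵘ (ι a)                                     ≃⟨ toℚᵘ-/ a 0 ⟩
    mkℚᵘ (+ a) 0                                     ≤⟨ ℚᵘ.*≤* cross ⟩
    mkℚᵘ (+ c) 0 ℚᵘ.* mkℚᵘ (+ n) D                   ≃⟨ ℚᵘₚ.*-cong (toℚᵘ-/ c 0) (toℚᵘ-/ n D) ⟨
    ℚ.toℚᵘ (ι c) ℚᵘ.* ℚ.toℚᵘ ((+ n) ℚ./ suc D)       ≃⟨ ℚₚ.toℚᵘ-homo-* (ι c) ((+ n) ℚ./ suc D) ⟨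
    ℚ.toℚᵘ (ι c * ((+ n) ℚ./ suc D))                 ∎)
    where
    open ℚᵘₚ.≤-Reasoning
    cross : + a ℤ.* + suc (D ℕ.+ 0) ℤ.≤ + c ℤ.* + n ℤ.* + 1
    cross = subst₂ ℤ._≤_
      (trans (ℤₚ.pos-* a (suc D)) (cong (λ t → + a ℤ.* + suc t) (sym (ℕₚ.+-identityʳ D))))
      (trans (ℤₚ.pos-* c n) (sym (ℤₚ.*-identityʳ (+ c ℤ.* + n)))) (ℤ.+≤+ le)

  ι-mono : ∀ {m n} → m ℕ.≤ n → ι m ≤ ι n
  ι-mono {m} {n} m≤n = ℚₚ.≤-trans (ι-≤-*/ m n 1 1 (ℕₚ.*-monoˡ-≤ 1 m≤n)) (ℚₚ.≤-reflexive (ℚₚ.*-identityʳ (ι n)))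

  ι-cancel : ∀ {m n} → ι m ≤ ι n → m ℕ.≤ n
  ι-cancel {m} {n} le = ℤ.drop‿+≤+ (subst₂ ℤ._≤_ (ℤₚ.*-identityʳ (+ m)) (ℤₚ.*-identityʳ (+ n)) (ℚᵘₚ.drop-*≤*
    (ℚᵘₚ.≤-respˡ-≃ (toℚᵘ-/ m 0) (ℚᵘₚ.≤-respʳ-≃ (toℚᵘ-/ n 0) (ℚₚ.toℚᵘ-mono-≤ le)))))

  *-mono-nonNeg : ∀ {p q r s} → 0ℚ ≤ p → p ≤ q → 0ℚ ≤ s → r ≤ s → p * r ≤ q * s
  *-mono-nonNeg {p} {q} {r} {s} 0≤p p≤q 0≤s r≤s = ℚₚ.≤-trans
    (ℚₚ.*-monoˡ-≤-nonNeg p {{ℚ.nonNegative 0≤p}} r≤s) (ℚₚ.*-monoʳ-≤-nonNeg s {{ℚ.nonNegative 0≤s}} p≤q)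

  0≤ι : ∀ n → 0ℚ ≤ ι n
  0≤ι n = ι-mono {0} {n} ℕ.z≤n

  pow-lower : ∀ b n {x} → ι b ≤ x → ι (b ℕ.^ n) ≤ pow x n
  pow-lower b zero ιb≤x = ℚₚ.≤-refl
  pow-lower b (suc n) {x} ιb≤x = ℚₚ.≤-trans
    (ι-≤-*/ (b ℕ.* b ℕ.^ n) b (b ℕ.^ n) 1 (ℕₚ.≤-reflexive (ℕₚ.*-identityʳ (b ℕ.* b ℕ.^ n))))
    (*-mono-nonNeg (0≤ι b) ιb≤x (ℚₚ.≤-trans (0≤ι (b ℕ.^ n)) (pow-lower b n ιb≤x)) (pow-lower b n ιb≤x))

  0≤pow : ∀ n {x} → 0ℚ ≤ x → 0ℚ ≤ pow x n
  0≤pow n 0≤x = ℚₚ.≤-trans (0≤ι (0 ℕ.^ n)) (pow-lower 0 n 0≤x)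

  0≤invFact : ∀ n → 0ℚ ≤ invFact n
  0≤invFact n = ℚₚ.nonNegative⁻¹ (invFact n) {{ℚₚ.normalize-nonNeg 1 (n !) {{ℕₚ._!≢0 n}}}}

  0≤expPartial : ∀ n {x} → 0ℚ ≤ x → 0ℚ ≤ expPartial n x
  0≤expPartial zero 0≤x = ℚₚ.≤-refl
  0≤expPartial (suc n) {x} 0≤x = ℚₚ.+-mono-≤ (0≤expPartial n 0≤x)
    (subst (_≤ pow x n * invFact n) (ℚₚ.*-zeroˡ (invFact n))
      (ℚₚ.*-monoʳ-≤-nonNeg (invFact n) {{ℚ.nonNegative (0≤invFact n)}} (0≤pow n 0≤x)))

  !≤^ : ∀ n → n ! ℕ.≤ n ℕ.^ n
  !≤^ zero = ℕₚ.≤-refl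
  !≤^ (suc n) = ℕₚ.*-monoʳ-≤ (suc n) (ℕₚ.≤-trans (!≤^ n) (ℕₚ.^-monoˡ-≤ n (ℕₚ.n≤1+n n)))

  ^-distribʳ-*ⁿ : ∀ m n k → (m ℕ.* n) ℕ.^ k ≡ m ℕ.^ k ℕ.* n ℕ.^ k
  ^-distribʳ-*ⁿ m n zero = refl
  ^-distribʳ-*ⁿ m n (suc k) = trans (cong (m ℕ.* n ℕ.*_) (^-distribʳ-*ⁿ m n k)) (interchange m n (m ℕ.^ k) (n ℕ.^ k))
    where
    interchange : ∀ a b c d → a ℕ.* b ℕ.* (c ℕ.* d) ≡ a ℕ.* c ℕ.* (b ℕ.* d)
    interchange = ℕ-Solver.solve-∀

  -- The single Taylor term x^m / m! with x = 2m already gives exp x ≥ 2^m.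
  exp-lower : ∀ m {x} → ι (2 ℕ.* m) ≤ x → ι (2 ℕ.^ m) ≤ expPartial (suc m) x
  exp-lower m {x} 2m≤x = begin
    ι (2 ℕ.^ m)                               ≤⟨ ι-≤-*/ (2 ℕ.^ m) ((2 ℕ.* m) ℕ.^ m) 1 (m !) {{ℕₚ._!≢0 m}} term ⟩
    ι ((2 ℕ.* m) ℕ.^ m) * invFact m           ≤⟨ ℚₚ.*-monoʳ-≤-nonNeg (invFact m) {{ℚ.nonNegative (0≤invFact m)}} (pow-lower (2 ℕ.* m) m 2m≤x) ⟩
    pow x m * invFact m                       ≡⟨ ℚₚ.+-identityˡ (pow x m * invFact m) ⟨
    0ℚ + pow x m * invFact m                  ≤⟨ ℚₚ.+-monoˡ-≤ (pow x m * invFact m) (0≤expPartial m (ℚₚ.≤-trans (0≤ι (2 ℕ.* m)) 2m≤x)) ⟩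
    expPartial (suc m) x                      ∎
    where
    open ℚₚ.≤-Reasoning
    -- (2m)^m = 2^m m^m, and m! is at most m^m.
    term : 2 ℕ.^ m ℕ.* m ! ℕ.≤ (2 ℕ.* m) ℕ.^ m ℕ.* 1
    term = ℕₚ.≤-trans (ℕₚ.*-monoʳ-≤ (2 ℕ.^ m) (!≤^ m))
      (ℕₚ.≤-reflexive (sym (trans (ℕₚ.*-identityʳ _) (^-distribʳ-*ⁿ 2 m m))))

  -- From t ≥ 2(k+1) follows exp t ≥ 2^(k+1) = 2 · 2^k, which is just the lower bound that a second
  -- use of `exp-lower`, with m = 2^k, asks for.
  expExp-lower : ∀ {t N} k → ι (2 ℕ.* suc k) ≤ t → ExpExpLe t N → 2 ℕ.^ (2 ℕ.^ k) ℕ.≤ N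
  expExp-lower k le bound = ι-cancel (ℚₚ.≤-trans (exp-lower (2 ℕ.^ k) (exp-lower (suc k) le))
    (bound (suc (2 ℕ.^ k)) (suc (suc k))))

open import Data.Fin.Subset using (Subset; ∣_∣; _∈_)

-- Translation between `Subset` and Boolean functions.

module Subsets where
  open import Data.Nat using (_+_; _≤_)

  member : ∀ {N} → Subset N → ℕ → Bool
  member [] _ = false
  member (b ∷ A) zero = b
  member (b ∷ A) (suc x) = member A x

  count-front : ∀ n B → count (suc n) B ≡ (if B 0 then 1 else 0) + count n (λ x → B (suc x))
  count-front zero B = ℕₚ.+-comm 0 _
  count-front (suc n) B = trans (cong (_+ (if B (suc n) then 1 else 0)) (count-front n B))
    (ℕₚ.+-assoc (if B 0 then 1 else 0) (count n (λ x → B (suc x))) (if B (suc n) then 1 else 0))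

  count-member : ∀ {N} (A : Subset N) → count N (member A) ≡ ∣ A ∣
  count-member [] = refl
  count-member {suc N} (true ∷ A) = trans (count-front N (member (true ∷ A))) (cong suc (count-member A))
  count-member {suc N} (false ∷ A) = trans (count-front N (member (false ∷ A))) (count-member A)

  member⇒∈ : ∀ {N} (A : Subset N) {x} → member A x ≡ true → Σ (Fin N) λ i → Fin.toℕ i ≡ x × i ∈ A
  member⇒∈ (true ∷ A) {zero} _ = Fin.zero , refl , here
  member⇒∈ (b ∷ A) {suc x} eq = let (i , toℕ≡ , i∈) = member⇒∈ A eq in Fin.suc i , cong suc toℕ≡ , there i∈

  nonempty : ∀ {N} (A : Subset N) → 1 ≤ ∣ A ∣ → ∃ λ i → i ∈ A
  nonempty (true ∷ A) _ = Fin.zero , here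
  nonempty (false ∷ A) 1≤ = let (i , i∈) = nonempty A 1≤ in Fin.suc i , there i∈

  -- Index i stands for i + 1; the unit is absorbed into the translate `suc a`.
  configuration⇒contains : ∀ {d N} (A : Subset N) → Configuration d N (member A) → ContainsNontrivialConfig d A
  configuration⇒contains A (a , n , injective , inA) = suc a , n , injective , λ i j i≤j →
    let (k , toℕ≡ , k∈) = member⇒∈ A (proj₂ (inA i j i≤j))
    in k , trans (cong suc toℕ≡) (sym (ℕₚ.+-suc (n i + n j) a)) , k∈

  -- The case d = 1 stands apart because d(d+1) - 1 is below 2d + 1 there. Its only sum is 2n + a,
  -- and n = 0 lets a be any element.
  contains-1 : ∀ {N} (A : Subset N) → 1 ≤ ∣ A ∣ → ContainsNontrivialConfig 1 A
  contains-1 A 1≤ = let (k , k∈) = nonempty A 1≤ in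
    suc (Fin.toℕ k) , (λ _ → 0) , (λ { {Fin.zero} {Fin.zero} _ → refl }) , (λ _ _ _ → k , refl , k∈)

-- Comparison of exponents and constants.

module Thresholds (m r : ℕ) (0<r : 0 ℕ.< r) where
  open import Data.Nat using (_+_; _*_; _≤_; _^_; z≤n; s≤s)
  open Exponential using (^-distribʳ-*ⁿ)

  private
    d E : ℕ
    d = 2 + m
    E = 4 * r * ((4 * r) ^ d * (4 * r) ^ d)

  -- The two sides differ by (d - 2)(d + 1) = m² + 3m; this is where d ≥ 2 enters.
  exponent-≤ : suc (d + d) ≤ d * suc d ∸ 1
  exponent-≤ = ℕₚ.≤-trans (ℕₚ.m≤m+n (suc (d + d)) (m * m + 3 * m)) (ℕₚ.≤-reflexive (cong (_∸ 1) (expand m)))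
    where
    expand : ∀ m → suc (suc ((2 + m) + (2 + m))) + (m * m + 3 * m) ≡ (2 + m) * suc (2 + m)
    expand = ℕ-Solver.solve-∀

  -- Here E = (4r)^(2d+1), and 6 + 50E ≤ 56E ≤ 4³E. As 3 ≤ 2d + 1, the constant 4³ is absorbed by
  -- passing from 4r to 16r.
  threshold : 2 * suc (2 + 25 * E) ≤ (16 * r) ^ (d * suc d ∸ 1)
  threshold = begin
    2 * suc (2 + 25 * E)                     ≡⟨ expand E ⟩
    6 * 1 + 50 * E                           ≤⟨ ℕₚ.+-monoˡ-≤ (50 * E) (ℕₚ.*-monoʳ-≤ 6 (Iteration.0<E r d 0<r)) ⟩
    6 * E + 50 * E                           ≡⟨ ℕₚ.*-distribʳ-+ E 6 50 ⟨
    56 * E                                   ≤⟨ ℕₚ.*-monoˡ-≤ E (ℕₚ.m≤m+n 56 8) ⟩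
    4 ^ 3 * E                                ≤⟨ ℕₚ.*-monoˡ-≤ E (ℕₚ.^-monoʳ-≤ 4 (s≤s (ℕₚ.≤-trans (s≤s (s≤s z≤n)) (ℕₚ.m≤m+n d d)))) ⟩
    4 ^ suc (d + d) * E                      ≡⟨ cong (4 ^ suc (d + d) *_) (cong (4 * r *_) (sym (ℕₚ.^-distribˡ-+-* (4 * r) d d))) ⟩
    4 ^ suc (d + d) * (4 * r) ^ suc (d + d)  ≡⟨ ^-distribʳ-*ⁿ 4 (4 * r) (suc (d + d)) ⟨
    (4 * (4 * r)) ^ suc (d + d)              ≡⟨ cong (_^ suc (d + d)) (sym (ℕₚ.*-assoc 4 4 r)) ⟩
    (16 * r) ^ suc (d + d)                   ≤⟨ ℕₚ.^-monoʳ-≤ (16 * r) {{ℕ.>-nonZero (ℕₚ.*-mono-< {0} {16} {0} {r} (s≤s z≤n) 0<r)}} exponent-≤ ⟩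
    (16 * r) ^ (d * suc d ∸ 1)               ∎
    where
    open ℕₚ.≤-Reasoning
    expand : ∀ e → 2 * suc (2 + 25 * e) ≡ 6 * 1 + 50 * e
    expand = ℕ-Solver.solve-∀

-- From the double exponential hypothesis to a configuration, for d ≥ 2.

module DenseSubsets where
  open import Data.Nat using (_+_; _*_; _≤_; _<_; _^_; z≤n; s≤s)
  open Exponential
  open Subsets

  -- With t = (32N/|A|)^D one has t ≥ (16r)^D ≥ 2(3 + 25E), and `expExp-lower` converts the bound on
  -- exp exp t into the size that `dense⇒configuration` requires.
  dense⇒contains : ∀ m N (A : Subset N) → 1 ≤ ∣ A ∣ →
    ExpExpLe (pow (ι 32 ℚ.* ratio N ∣ A ∣) ((2 + m) * suc (2 + m) ∸ 1)) N → ContainsNontrivialConfig (2 + m) A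
  dense⇒contains m N A 1≤α bound = configuration⇒contains A
    (Iteration.dense⇒configuration r (2 + m) 0<r N (member A)
      (subst (λ t → N ≤ r * t) (sym (count-member A)) N≤rα)
      (expExp-lower (2 + 25 * E)
        (ℚₚ.≤-trans (ι-mono (Thresholds.threshold m r 0<r)) (pow-lower (16 * r) D base)) bound))
    where
    open ℕₚ.≤-Reasoning
    α r D E : ℕ
    α = ∣ A ∣
    instance
      α≢0 : ℕ.NonZero α
      α≢0 = ℕ.>-nonZero 1≤α
    -- This integer satisfies N ≤ rα ≤ 2N: the first inequality gives the density bound, the second
    -- turns 16r into 32N/α, whence C = 32.
    r = suc (N / α)
    D = (2 + m) * suc (2 + m) ∸ 1
    E = 4 * r * ((4 * r) ^ (2 + m) * (4 * r) ^ (2 + m))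
    0<r : 0 < r
    0<r = s≤s z≤n
    N≤rα : N ≤ r * α
    N≤rα = begin
      N                      ≡⟨ m≡m%n+[m/n]*n N α ⟩
      N % α + N / α * α      ≤⟨ ℕₚ.+-monoˡ-≤ (N / α * α) (ℕₚ.<⇒≤ (m%n<n N α)) ⟩
      r * α                  ∎
    rα≤2N : 16 * r * α ≤ 32 * N
    rα≤2N = begin
      16 * r * α             ≡⟨ ℕₚ.*-assoc 16 r α ⟩
      16 * (r * α)           ≤⟨ ℕₚ.*-monoʳ-≤ 16 (ℕₚ.+-mono-≤ (subst (_≤ N) (count-member A) (count-≤ N (member A))) (m/n*n≤m N α)) ⟩
      16 * (N + N)           ≡⟨ double N ⟩
      32 * N                 ∎
      where
      double : ∀ n → 16 * (n + n) ≡ 32 * n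
      double = ℕ-Solver.solve-∀
    ratio≡ : ∀ a .{{_ : ℕ.NonZero a}} → ratio N a ≡ (+ N) ℚ./ a
    ratio≡ (suc a) = refl
    base : ι (16 * r) ℚ.≤ ι 32 ℚ.* ratio N α
    base = subst (λ t → ι (16 * r) ℚ.≤ ι 32 ℚ.* t) (sym (ratio≡ α)) (ι-≤-*/ (16 * r) 32 N α rα≤2N)

theorem2p13 : Σ ℚ λ C → (0ℚ ℚ.< C) ×
    (∀ (d N : ℕ) → 1 ℕ.≤ d → 3 ℕ.≤ N → (A : Subset N) →
    1 ℕ.≤ ∣ A ∣ →
    ExpExpLe (pow (C ℚ.* ratio N ∣ A ∣) (d ℕ.* suc d ∸ 1)) N →
    ContainsNontrivialConfig d A)
theorem2p13 = Exponential.ι 32 , ℚ.*<* (ℤ.+<+ (ℕ.s≤s ℕ.z≤n)) , contains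
  where
  contains : ∀ d N → 1 ℕ.≤ d → 3 ℕ.≤ N → (A : Subset N) → 1 ℕ.≤ ∣ A ∣ →
    ExpExpLe (pow (Exponential.ι 32 ℚ.* ratio N ∣ A ∣) (d ℕ.* suc d ∸ 1)) N → ContainsNontrivialConfig d A
  contains 1 N _ _ A 1≤α _ = Subsets.contains-1 A 1≤α
  contains (suc (suc m)) N _ _ A 1≤α bound = DenseSubsets.dense⇒contains m N A 1≤α bound
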